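{- Let $m\ge 3$. Call $\mathbf{x}=(x_1,\ldots,x_m)\in\mathbb{R}^m$ generic if the $\binom{m}{2}$ midpoints $(x_i+x_j)/2$, $1\le i<j\le m$, are pairwise distinct (in particular the $x_i$ are pairwise distinct). For such $\mathbf{x}$ define its ranking pattern $$\mathrm{RP}^{\mathrm{UF}}(\mathbf{x})=\{(i_1\cdots i_m)\in\mathbb{P}_m:\ |y-x_{i_1}|<\cdots<|y-x_{i_m}|\text{ for some }y\in\mathbb{R}\},$$ where $\mathbb{P}_m$ is the set of permutations $(i_1\cdots i_m)$ of $[m]=\{1,\ldots,m\}$. Two ranking patterns $\mathrm{RP}^{\mathrm{UF}}(\mathbf{x})$, $\mathrm{RP}^{\mathrm{UF}}(\mathbf{x}')$ are called equivalent if $\mathrm{RP}^{\mathrm{UF}}(\mathbf{x})=\{(\sigma(i_1)\cdots\sigma(i_m)):(i_1\cdots i_m)\in\mathrm{RP}^{\mathrm{UF}}(\mathbf{x}')\}$ for some bijection $\sigma:[m]\to[m]$. Let $r_{\mathrm{IE}}(m)$ be the number of equivalence classes of ranking patterns $\mathrm{RP}^{\mathrm{UF}}(\mathbf{x})$ with $\mathbf{x}\in\mathbb{R}^m$ generic, and let $r_0(m)$ be the number of distinct ranking patterns $\mathrm{RP}^{\mathrm{UF}}(\mathbf{x})$ with $\mathbf{x}$ generic and $x_1<\cdots<x_m$. Let $\mathcal{B}_m$ be the braid arrangement $\{\{x_i=x_j\}:1\le i<j\le m\}$ in $\mathbb{R}^m$ and $\mathcal{M}_m$ the mid-hyperplane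 arrangement consisting of the hyperplanes of $\mathcal{B}_m$ together with the hyperplanes $\{x_i+x_j=x_k+x_l\}$ for all $(i,j,k,l)$ with $i,j,k,l$ pairwise distinct, $1\le i<j\le m$, $i<k<l\le m$. Then $$r_{\mathrm{IE}}(m)=\begin{cases} r_0(3)=\dfrac{|\mathrm{ch}(\mathcal{B}_3)|}{3!}=1, & m=3,\\[2mm] \dfrac{r_0(m)}{2}=\dfrac{|\mathrm{ch}(\mathcal{M}_m)|}{2\cdot m!}, & m\ge 4,\end{cases}$$ where $\mathrm{ch}(\cdot)$ denotes the set of chambers (connected components of the complement of the union of the hyperplanes) of an arrangement. -}

module Defs where

open import Level using (0ℓ; suc)
open import Algebra.Bundles using (CommutativeRing)
open import Data.Fin.Base using (Fin; _<_)
open import Data.Fin.Permutation using (Permutation′; _⟨$⟩ʳ_; _⟨$⟩ˡ_; _∘ₚ_; inverseˡ)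
  renaming (id to idₚ; flip to flipₚ; _≈_ to _≈ₚ_)
open import Data.Nat.Base as ℕ using (ℕ; _!; NonZero)
open import Data.Nat.Properties using (_!≢0; m*n≢0)
open import Data.Product.Base using (Σ; ∃; _×_; _,_; proj₁; proj₂)
open import Data.Sum.Base using (_⊎_; inj₁; inj₂; [_,_]′)
open import Data.Vec.Functional using (Vector)
open import Function.Base using (_∘_; _on_)
open import Function.Bundles using (Bijection)
open import Relation.Binary.Bundles using (Setoid)
open import Relation.Binary.Core using (Rel)
open import Relation.Binary.Definitions using (tri<; tri≈; tri>)
open import Relation.Binary.PropositionalEquality as ≡ using (_≡_; _≢_)
open import Relation.Binary.Structures using (IsStrictTotalOrder)
import Relation.Binary.Construct.On as On
open import Relation.Nullary.Negation using (¬_)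
open import Relation.Unary using (Pred; _∈_; _∉_; _⊆_; _∪_; _∩_; _≐_; Satisfiable)
open import Relation.Unary.Relation.Binary.Equality using (≐-setoid)

-- The number of classes of a setoid (i.e. of elements of the quotient) is n.
_hasCardinality_ : ∀ {a ℓ} → Setoid a ℓ → ℕ → Set _
S hasCardinality n = Bijection (≡.setoid (Fin n)) S

2*m!≢0 : ∀ m → NonZero (2 ℕ.* m !)
2*m!≢0 m = m*n≢0 2 (m !) {{_}} {{m !≢0}}

-- The real numbers, axiomatised as a Dedekind-complete ordered field; this
-- determines them up to unique isomorphism in classical mathematics.  (Given
-- excluded middle a model exists in Set, e.g. cuts represented as ℚ → Bool.)
record CompleteOrderedField : Set₁ where
  field
    commutativeRing : CommutativeRing 0ℓ 0ℓ
  open CommutativeRing commutativeRing public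
    using (Carrier; _≈_; _+_; _*_; -_; _-_; 0#; 1#)
  infix 4 _<ᴿ_
  field
    _<ᴿ_               : Rel Carrier 0ℓ
    isStrictTotalOrder : IsStrictTotalOrder _≈_ _<ᴿ_
    0<1                : 0# <ᴿ 1#
    +-monoʳ-<          : ∀ x {y z} → y <ᴿ z → x + y <ᴿ x + z
    *-pos              : ∀ {x y} → 0# <ᴿ x → 0# <ᴿ y → 0# <ᴿ x * y
    inverse            : ∀ x → ¬ (x ≈ 0#) → ∃ λ y → x * y ≈ 1#

  _IsUpperBoundOf_ : Carrier → Pred Carrier 0ℓ → Set
  b IsUpperBoundOf S = ∀ x → x ∈ S → ¬ (b <ᴿ x)

  field
    supremum : (S : Pred Carrier 0ℓ) → Satisfiable S → (∃ λ b → b IsUpperBoundOf S) →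
               ∃ λ s → s IsUpperBoundOf S × (∀ b → b IsUpperBoundOf S → ¬ (b <ᴿ s))

module Euclidean (ℝ : CompleteOrderedField) where

  open CompleteOrderedField ℝ
  open CommutativeRing commutativeRing using (+-identityʳ) renaming (sym to ≈-sym)
  open IsStrictTotalOrder isStrictTotalOrder
    using (compare; irrefl; <-respˡ-≈) renaming (trans to <-trans)

  2≉0 : ¬ (1# + 1# ≈ 0#)
  2≉0 2≈0 = irrefl (≈-sym 2≈0)
    (<-trans 0<1 (<-respˡ-≈ (+-identityʳ 1#) (+-monoʳ-< 1# 0<1)))

  ½ : Carrier
  ½ = proj₁ (inverse (1# + 1#) 2≉0)

  ∣_∣ : Carrier → Carrier
  ∣ x ∣ with compare x 0#
  ... | tri< _ _ _ = - x
  ... | tri≈ _ _ _ = x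
  ... | tri> _ _ _ = x

  Point : ℕ → Set
  Point m = Vector Carrier m

  module _ {m : ℕ} where

    -- The topology of the maximum norm, i.e. the Euclidean topology.
    Open : Pred (Pred (Point m) 0ℓ) 0ℓ
    Open U = ∀ {x} → x ∈ U →
      ∃ λ ε → 0# <ᴿ ε × (∀ {y} → (∀ i → ∣ y i - x i ∣ <ᴿ ε) → y ∈ U)

    Connected : Pred (Pred (Point m) 0ℓ) (suc 0ℓ)
    Connected S = ∀ (U V : Pred (Point m) 0ℓ) → Open U → Open V → S ⊆ U ∪ V →
      Satisfiable (S ∩ U) → Satisfiable (S ∩ V) → Satisfiable (S ∩ (U ∩ V))

    SameComponent : Pred (Point m) 0ℓ → Rel (Point m) (suc 0ℓ)
    SameComponent X x y = ∃ λ S → S ⊆ X × Connected S × x ∈ S × y ∈ S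

    singleton-connected : ∀ x → Connected (_≡_ x)
    singleton-connected x U V _ _ _ (_ , ≡.refl , xU) (_ , ≡.refl , xV) =
      x , ≡.refl , xU , xV

    ∪-connected : ∀ {S T} → Connected S → Connected T →
                  Satisfiable (S ∩ T) → Connected (S ∪ T)
    ∪-connected {S} {T} cS cT (p , pS , pT) U V oU oV cov (a , a∈ , aU) (b , b∈ , bV) =
      [ inU b∈ , inV a∈ ]′ (cov (inj₁ pS))
      where
      viaS : Satisfiable (S ∩ U) → Satisfiable (S ∩ V) → Satisfiable ((S ∪ T) ∩ (U ∩ V))
      viaS u v with cS U V oU oV (cov ∘ inj₁) u v
      ... | z , zS , zUV = z , inj₁ zS , zUV
      viaT : Satisfiable (T ∩ U) → Satisfiable (T ∩ V) → Satisfiable ((S ∪ T) ∩ (U ∩ V))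
      viaT u v with cT U V oU oV (cov ∘ inj₂) u v
      ... | z , zT , zUV = z , inj₂ zT , zUV
      inU : b ∈ S ∪ T → p ∈ U → Satisfiable ((S ∪ T) ∩ (U ∩ V))
      inU (inj₁ bS) pU = viaS (p , pS , pU) (b , bS , bV)
      inU (inj₂ bT) pU = viaT (p , pT , pU) (b , bT , bV)
      inV : a ∈ S ∪ T → p ∈ V → Satisfiable ((S ∪ T) ∩ (U ∩ V))
      inV (inj₁ aS) pV = viaS (a , aS , aU) (p , pS , pV)
      inV (inj₂ aT) pV = viaT (a , aT , aU) (p , pT , pV)

    -- The connected components of X, as the quotient of X by lying in a common
    -- connected subset of X.
    components : Pred (Point m) 0ℓ → Setoid 0ℓ (suc 0ℓ)
    components X = record
      { Carrier       = Σ (Point m) X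
      ; _≈_           = SameComponent X on proj₁
      ; isEquivalence = record
        { refl  = λ {(x , xX)} →
            _≡_ x , (λ { ≡.refl → xX }) , singleton-connected x , ≡.refl , ≡.refl
        ; sym   = λ (S , S⊆X , cS , xS , yS) → S , S⊆X , cS , yS , xS
        ; trans = λ (S , S⊆X , cS , xS , yS) (T , T⊆X , cT , yT , zT) →
            S ∪ T , [ S⊆X , T⊆X ]′ , ∪-connected cS cT (_ , yS , yT) , inj₁ xS , inj₂ zT
        }
      }

  record Arrangement (m : ℕ) : Set₁ where
    field
      Index      : Set
      hyperplane : Index → Pred (Point m) 0ℓ

    complement : Pred (Point m) 0ℓ
    complement x = ∀ i → x ∉ hyperplane i

    ch : Setoid 0ℓ (suc 0ℓ)
    ch = components complement

  open Arrangement public using (ch)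

  data BraidIndex (m : ℕ) : Set where
    mk : (i j : Fin m) → i < j → BraidIndex m

  braidHyperplane : ∀ {m} → BraidIndex m → Pred (Point m) 0ℓ
  braidHyperplane (mk i j _) x = x i ≈ x j

  data MidIndex (m : ℕ) : Set where
    mk : (i j k l : Fin m) →
         i ≢ j → i ≢ k → i ≢ l → j ≢ k → j ≢ l → k ≢ l →
         i < j → i < k → k < l → MidIndex m

  midHyperplane : ∀ {m} → MidIndex m → Pred (Point m) 0ℓ
  midHyperplane (mk i j k l _ _ _ _ _ _ _ _ _) x = x i + x j ≈ x k + x l

  𝓑 : ∀ m → Arrangement m
  𝓑 m = record { Index = BraidIndex m ; hyperplane = braidHyperplane }

  𝓜 : ∀ m → Arrangement m
  𝓜 m = record
    { Index      = BraidIndex m ⊎ MidIndex m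
    ; hyperplane = [ braidHyperplane , midHyperplane ]′
    }

module RankingPatterns (ℝ : CompleteOrderedField) where

  open CompleteOrderedField ℝ
  open Euclidean ℝ

  module _ {m : ℕ} where

    midpoint : Point m → Fin m → Fin m → Carrier
    midpoint x i j = (x i + x j) * ½

    Generic : Pred (Point m) 0ℓ
    Generic x = ∀ {i j k l} → i < j → k < l →
                midpoint x i j ≈ midpoint x k l → i ≡ k × j ≡ l

    Increasing : Pred (Point m) 0ℓ
    Increasing x = ∀ {i j} → i < j → x i <ᴿ x j

    -- The permutation (i₁ ⋯ iₘ) is represented by π with π ⟨$⟩ʳ k = iₖ.
    RP : Point m → Pred (Permutation′ m) 0ℓ
    RP x π = ∃ λ y → ∀ {k l} → k < l →
             ∣ y - x (π ⟨$⟩ʳ k) ∣ <ᴿ ∣ y - x (π ⟨$⟩ʳ l) ∣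

    -- The image of P under (i₁ ⋯ iₘ) ↦ (σ(i₁) ⋯ σ(iₘ)); in π ∘ₚ σ, π acts first.
    _·_ : Permutation′ m → Pred (Permutation′ m) 0ℓ → Pred (Permutation′ m) 0ℓ
    (σ · P) ρ = ∃ λ π → π ∈ P × ρ ≈ₚ (π ∘ₚ σ)

    Equivalent : Rel (Point m) 0ℓ
    Equivalent x x′ = ∃ λ σ → RP x ≐ (σ · RP x′)

    RP-resp-≈ₚ : ∀ x {π ρ} → π ≈ₚ ρ → π ∈ RP x → ρ ∈ RP x
    RP-resp-≈ₚ x π≈ρ (y , f) = y , λ {k} {l} k<l →
      ≡.subst₂ (λ a b → ∣ y - x a ∣ <ᴿ ∣ y - x b ∣) (π≈ρ k) (π≈ρ l) (f k<l)

    Equivalent-refl : ∀ x → Equivalent x x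
    Equivalent-refl x = idₚ
      , (λ {π} p → π , p , λ _ → ≡.refl)
      , λ {ρ} (π , p , ρ≈π) → RP-resp-≈ₚ x {π} {ρ} (≡.sym ∘ ρ≈π) p

    Equivalent-sym : ∀ x x′ → Equivalent x x′ → Equivalent x′ x
    Equivalent-sym x x′ (σ , f , g) = flipₚ σ
      , (λ {π} p → π ∘ₚ σ , g {π ∘ₚ σ} (π , p , λ _ → ≡.refl) , λ _ → ≡.sym (inverseˡ σ))
      , λ {ρ} (π , p , ρ≈) → let (τ , q , π≈) = f {π} p in
          RP-resp-≈ₚ x′ {τ} {ρ} (λ k → ≡.sym (≡.trans (ρ≈ k)
            (≡.trans (≡.cong (σ ⟨$⟩ˡ_) (π≈ k)) (inverseˡ σ)))) q

    Equivalent-trans : ∀ x x′ x″ → Equivalent x x′ → Equivalent x′ x″ → Equivalent x x″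
    Equivalent-trans x x′ x″ (σ , f , g) (τ , f′ , g′) = τ ∘ₚ σ
      , (λ {ρ} p → let (π , q , ρ≈) = f {ρ} p
                       (θ , r , π≈) = f′ {π} q
                   in θ , r , λ k → ≡.trans (ρ≈ k) (≡.cong (σ ⟨$⟩ʳ_) (π≈ k)))
      , λ {ρ} (θ , r , ρ≈) → g {ρ} (θ ∘ₚ τ , g′ {θ ∘ₚ τ} (θ , r , λ _ → ≡.refl) , ρ≈)

  -- Ranking patterns RP x with x generic, counted up to equivalence.
  IE-classes : ℕ → Setoid 0ℓ 0ℓ
  IE-classes m = record
    { Carrier       = Σ (Point m) Generic
    ; _≈_           = Equivalent on proj₁
    ; isEquivalence = record
      { refl  = λ {(x , _)} → Equivalent-refl x
      ; sym   = λ {(x , _)} {(x′ , _)} → Equivalent-sym x x′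
      ; trans = λ {(x , _)} {(x′ , _)} {(x″ , _)} → Equivalent-trans x x′ x″
      }
    }

  -- Ranking patterns RP x with x generic and increasing, counted as sets.
  orderedPatterns : ℕ → Setoid 0ℓ 0ℓ
  orderedPatterns m = On.setoid (≐-setoid (Permutation′ m) 0ℓ)
    λ ((x , _) : Σ (Point m) (Generic ∩ Increasing)) → RP x

{-# OPTIONS --safe #-}
module Submission where

-- A point y ranks xᵢ before xⱼ (for xᵢ < xⱼ) exactly when it lies to the left of their midpoint.
-- For an increasing generic x the ranking pattern therefore determines, and is determined by,
-- the order of the midpoints, that is, the signs of all xᵢ + xⱼ − xₖ − xₗ. These signs also
-- determine the chamber of 𝓜 containing x: the points keeping the signs shared by two given
-- points form a convex, hence connected, set. Sorting the coordinates then shows that 𝓜 has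
-- r₀(m) · m! chambers. The rankings (1 ⋯ m) and (m ⋯ 1) are the only ones in the pattern of an
-- increasing x that are reverses of each other, so a relabelling between two such patterns is the
-- identity or the reversal x ↦ (−xₘ, …, −x₁). For m ≥ 4 the latter acts freely on midpoint
-- orders, since it changes the sign of (x₁ + xₘ) − (x₂ + xₘ₋₁); for m = 3 there is only one order.

open import Defs
open import Level using (Level; 0ℓ)
open import Algebra.Bundles using (CommutativeRing)
import Algebra.Properties.AbelianGroup as AbelianGroupProperties
import Algebra.Properties.Monoid.Mult as Mult
import Algebra.Properties.Ring as RingProperties
import Algebra.Properties.Semiring.Mult as SemiringMult
import Algebra.Solver.Ring as RingSolver
open import Algebra.Solver.Ring.AlmostCommutativeRing
  using (fromCommutativeRing; _-Raw-AlmostCommutative⟶_)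
open import Axiom.ExcludedMiddle using (ExcludedMiddle)
open import Data.Empty using (⊥-elim)
open import Data.Fin.Base as Fin
  using (Fin; zero; suc; toℕ; inject₁; opposite; punchIn; combine; remQuot; splitAt; join)
import Data.Fin.Induction as Fin
open import Data.Fin.Permutation
  using (Permutation′; _⟨$⟩ʳ_; _⟨$⟩ˡ_; _∘ₚ_; inverseˡ; inverseʳ;
         insert; insert-punchIn; insert-remove; remove)
  renaming (id to idₚ; flip to flipₚ; _≈_ to _≈ₚ_; reverse to reverseₚ)
import Data.Fin.Properties as Fin
open import Data.Integer.Base as ℤ using (ℤ; +_; -[1+_]; +0; +[1+_]; _◃_; _⊖_)
import Data.Integer.Properties as ℤ
import Data.Maybe.Base as Maybe
open import Data.Nat.Base as ℕ using (ℕ; zero; suc; _!; NonZero)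
import Data.Nat.Properties as ℕ
open import Data.Product.Base using (Σ; ∃; _×_; _,_; proj₁; proj₂; map₂; uncurry)
open import Data.Rational.Base using (_/_; 1ℚ)
import Data.Rational.Properties as ℚ
open import Data.Rational.Unnormalised.Base using (mkℚᵘ; *≡*)
open import Data.Sign.Base as Sign using (Sign)
open import Data.Sum.Base as Sum using (_⊎_; inj₁; inj₂; [_,_]′)
open import Data.Unit.Base using (⊤; tt)
open import Data.Vec.Functional using (_∷_; [])
open import Function.Base using (_∘_; _on_)
open import Function.Bundles using (Bijection; _⇔_; mk⇔; module Equivalence)
open import Relation.Binary.Bundles using (Setoid)
open import Relation.Binary.Core using (Rel)
open import Relation.Binary.Definitions using (tri<; tri≈; tri>)
open import Relation.Binary.PropositionalEquality as ≡ using (_≡_; _≢_)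
open import Relation.Binary.Structures using (IsStrictTotalOrder)
open import Relation.Nullary.Decidable using (Dec; yes; no; dec⇒maybe; decidable-stable; _×-dec_)
open import Relation.Nullary.Negation using (¬_; contradiction)
open import Relation.Unary using (Pred; _∈_; _⊆_; _≐_; _∪_; _∩_; Satisfiable)

-- Ordered fields

-- A cardinality has to be exhibited as a bijection from some `Fin n`, yet no formula supplies `n`.
-- The way out is that a midpoint order is the outcome of finitely many yes-no tests on a point, and
-- excluded middle picks one point for each outcome that occurs. For m ≥ 4 this is done only for the
-- orders that put the midpoint of the outermost pair before that of the next pair inwards. Their
-- number is r_IE(m), and adjoining the mirror images makes r₀(m) twice that number, so that no
-- halving has to be justified. Ranking patterns and midpoint orders determine each other because
-- the midpoints are finite in number: there is room for a viewpoint strictly between two different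
-- ones, and every cut of them is realised by a point. Completeness of the field enters only through
-- the connectedness of convex sets.

module IntegerRingSolver (R : CommutativeRing 0ℓ 0ℓ) where
  open CommutativeRing R
  open AbelianGroupProperties +-abelianGroup using (⁻¹-∙-comm; ε⁻¹≈ε; ⁻¹-involutive)
  open RingProperties ring using (-‿distribˡ-*; -‿distribʳ-*)
  open Mult +-monoid using (×-homo-+) renaming (_×_ to _·_)
  open SemiringMult semiring using (×1-homo-*)
  open import Relation.Binary.Reasoning.Setoid setoid

  -- Cancellation in normal forms needs an equality test on coefficients that computes. Hence the
  -- coefficients are integers, and the rest of the module shows that their canonical map to the
  -- ring is a homomorphism.
  ⟦_⟧ : ℤ → Carrier
  ⟦ + n ⟧      = n · 1#
  ⟦ -[1+ n ] ⟧ = - (suc n · 1#)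

  private
    signed : Sign → Carrier → Carrier
    signed Sign.+ x = x
    signed Sign.- x = - x

    cancel-1 : ∀ a b → a - b ≈ (1# + a) - (1# + b)
    cancel-1 a b = sym (begin
      (1# + a) + - (1# + b)     ≈⟨ +-congˡ (sym (⁻¹-∙-comm 1# b)) ⟩
      (1# + a) + (- 1# + - b)   ≈⟨ +-congʳ (+-comm 1# a) ⟩
      (a + 1#) + (- 1# + - b)   ≈⟨ +-assoc a 1# _ ⟩
      a + (1# + (- 1# + - b))   ≈⟨ +-congˡ (sym (+-assoc 1# (- 1#) (- b))) ⟩
      a + ((1# + - 1#) + - b)   ≈⟨ +-congˡ (+-congʳ (-‿inverseʳ 1#)) ⟩
      a + (0# + - b)            ≈⟨ +-congˡ (+-identityˡ (- b)) ⟩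
      a - b                     ∎)

    ⊖-homo : ∀ m n → ⟦ m ⊖ n ⟧ ≈ m · 1# - n · 1#
    ⊖-homo zero    zero    = sym (-‿inverseʳ 0#)
    ⊖-homo zero    (suc n) = sym (+-identityˡ _)
    ⊖-homo (suc m) zero    = sym (trans (+-congˡ ε⁻¹≈ε) (+-identityʳ _))
    ⊖-homo (suc m) (suc n) = begin
      ⟦ suc m ⊖ suc n ⟧          ≡⟨ ≡.cong ⟦_⟧ (ℤ.[1+m]⊖[1+n]≡m⊖n m n) ⟩
      ⟦ m ⊖ n ⟧                  ≈⟨ ⊖-homo m n ⟩
      m · 1# - n · 1#            ≈⟨ cancel-1 _ _ ⟩
      suc m · 1# - suc n · 1#    ∎

    ⟦⟧-homo-+ : ∀ i j → ⟦ i ℤ.+ j ⟧ ≈ ⟦ i ⟧ + ⟦ j ⟧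
    ⟦⟧-homo-+ (+ m)      (+ n)      = ×-homo-+ 1# m n
    ⟦⟧-homo-+ (+ m)      -[1+ n ]   = ⊖-homo m (suc n)
    ⟦⟧-homo-+ -[1+ m ]   (+ n)      = trans (⊖-homo n (suc m)) (+-comm _ _)
    ⟦⟧-homo-+ -[1+ m ]   -[1+ n ]   = begin
      - (suc (suc (m ℕ.+ n)) · 1#)         ≡⟨ ≡.cong (λ k → - (suc k · 1#)) (ℕ.+-suc m n) ⟨
      - ((suc m ℕ.+ suc n) · 1#)           ≈⟨ -‿cong (×-homo-+ 1# (suc m) (suc n)) ⟩
      - (suc m · 1# + suc n · 1#)          ≈⟨ sym (⁻¹-∙-comm _ _) ⟩
      - (suc m · 1#) + - (suc n · 1#)      ∎

    ◃-homo : ∀ s n → ⟦ s ◃ n ⟧ ≈ signed s (n · 1#)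
    ◃-homo Sign.+ zero    = refl
    ◃-homo Sign.- zero    = sym ε⁻¹≈ε
    ◃-homo Sign.+ (suc n) = refl
    ◃-homo Sign.- (suc n) = refl

    sign-abs : ∀ i → ⟦ i ⟧ ≡ signed (ℤ.sign i) (ℤ.∣ i ∣ · 1#)
    sign-abs (+ n)    = ≡.refl
    sign-abs -[1+ n ] = ≡.refl

    signed-cong : ∀ s {x y} → x ≈ y → signed s x ≈ signed s y
    signed-cong Sign.+ = λ p → p
    signed-cong Sign.- = -‿cong

    signed-* : ∀ s t x y → signed (s Sign.* t) (x * y) ≈ signed s x * signed t y
    signed-* Sign.+ Sign.+ x y = refl
    signed-* Sign.+ Sign.- x y = -‿distribʳ-* x y
    signed-* Sign.- Sign.+ x y = -‿distribˡ-* x y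
    signed-* Sign.- Sign.- x y = begin
      x * y          ≈⟨ sym (⁻¹-involutive (x * y)) ⟩
      - - (x * y)    ≈⟨ -‿cong (-‿distribʳ-* x y) ⟩
      - (x * - y)    ≈⟨ -‿distribˡ-* x (- y) ⟩
      - x * - y      ∎

    ⟦⟧-homo-* : ∀ i j → ⟦ i ℤ.* j ⟧ ≈ ⟦ i ⟧ * ⟦ j ⟧
    ⟦⟧-homo-* i j = begin
      ⟦ i ℤ.* j ⟧
        ≈⟨ ◃-homo (ℤ.sign i Sign.* ℤ.sign j) (ℤ.∣ i ∣ ℕ.* ℤ.∣ j ∣) ⟩
      signed (ℤ.sign i Sign.* ℤ.sign j) ((ℤ.∣ i ∣ ℕ.* ℤ.∣ j ∣) · 1#)
        ≈⟨ signed-cong (ℤ.sign i Sign.* ℤ.sign j) (×1-homo-* ℤ.∣ i ∣ ℤ.∣ j ∣) ⟩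
      signed (ℤ.sign i Sign.* ℤ.sign j) ((ℤ.∣ i ∣ · 1#) * (ℤ.∣ j ∣ · 1#))
        ≈⟨ signed-* (ℤ.sign i) (ℤ.sign j) _ _ ⟩
      signed (ℤ.sign i) (ℤ.∣ i ∣ · 1#) * signed (ℤ.sign j) (ℤ.∣ j ∣ · 1#)
        ≡⟨ ≡.cong₂ _*_ (≡.sym (sign-abs i)) (≡.sym (sign-abs j)) ⟩
      ⟦ i ⟧ * ⟦ j ⟧ ∎

    ⟦⟧-homo-‿ : ∀ i → ⟦ ℤ.- i ⟧ ≈ - ⟦ i ⟧
    ⟦⟧-homo-‿ +0         = sym ε⁻¹≈ε
    ⟦⟧-homo-‿ +[1+ n ]   = refl
    ⟦⟧-homo-‿ -[1+ n ]   = sym (⁻¹-involutive _)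

    morphism : ℤ.+-*-rawRing -Raw-AlmostCommutative⟶ fromCommutativeRing R
    morphism = record
      { ⟦_⟧    = ⟦_⟧
      ; +-homo = ⟦⟧-homo-+
      ; *-homo = ⟦⟧-homo-*
      ; -‿homo = ⟦⟧-homo-‿
      ; 0-homo = refl
      ; 1-homo = +-identityʳ 1#
      }

  open RingSolver ℤ.+-*-rawRing (fromCommutativeRing R) morphism
    (λ i j → Maybe.map (reflexive ∘ ≡.cong ⟦_⟧) (dec⇒maybe (i ℤ.≟ j)))
    public using (solve; con; _:+_; _:-_; _:*_; :-_; _:=_)

module OrderedField (ℝ : CompleteOrderedField) where
  open CompleteOrderedField ℝ
  open Euclidean ℝ
  open CommutativeRing commutativeRing
    using (refl; sym; trans; +-congˡ; +-congʳ; +-cong; *-congˡ; *-congʳ; -‿cong;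
           +-identityʳ; +-identityˡ; *-identityʳ; -‿inverseˡ; zeroʳ)
  open IsStrictTotalOrder isStrictTotalOrder
    using (compare; _<?_; irrefl; asym; <-respˡ-≈; <-respʳ-≈) renaming (trans to <-trans)
  open IntegerRingSolver commutativeRing

  <-resp₂ : ∀ {a a′ b b′} → a ≈ a′ → b ≈ b′ → a <ᴿ b → a′ <ᴿ b′
  <-resp₂ p q = <-respˡ-≈ p ∘ <-respʳ-≈ q

  <-irrefl : ∀ {a} → ¬ (a <ᴿ a)
  <-irrefl = irrefl refl

  -- Certifies most inequalities below: a quantity known to be positive, and a ring identity left to
  -- the solver.
  <-via : ∀ {a b p} → 0# <ᴿ p → p ≈ b - a → a <ᴿ b
  <-via {a} {b} 0<p p≈ = <-resp₂ (+-identityʳ a)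
    (trans (+-congˡ p≈) (solve 2 (λ a b → a :+ (b :- a) := b) refl a b))
    (+-monoʳ-< a 0<p)

  diff : ∀ {a b} → a <ᴿ b → 0# <ᴿ b - a
  diff {a} {b} a<b = <-resp₂ (-‿inverseˡ a)
    (solve 2 (λ a b → :- a :+ b := b :- a) refl a b) (+-monoʳ-< (- a) a<b)

  +-mono-< : ∀ {a b c d} → a <ᴿ b → c <ᴿ d → a + c <ᴿ b + d
  +-mono-< {a} {b} {c} {d} a<b c<d = <-trans (+-monoʳ-< a c<d)
    (<-via (diff a<b) (solve 3 (λ a b d → b :- a := (b :+ d) :- (a :+ d)) refl a b d))

  +-pos : ∀ {a b} → 0# <ᴿ a → 0# <ᴿ b → 0# <ᴿ a + b
  +-pos 0<a 0<b = <-respˡ-≈ (+-identityʳ 0#) (+-mono-< 0<a 0<b)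

  +-monoˡ-< : ∀ c {a b} → a <ᴿ b → a + c <ᴿ b + c
  +-monoˡ-< c {a} {b} a<b =
    <-via (diff a<b) (solve 3 (λ a b c → b :- a := (b :+ c) :- (a :+ c)) refl a b c)

  +-cancelʳ-< : ∀ c {a b} → a + c <ᴿ b + c → a <ᴿ b
  +-cancelʳ-< c {a} {b} p =
    <-via (diff p) (solve 3 (λ a b c → (b :+ c) :- (a :+ c) := b :- a) refl a b c)

  +-cancelˡ-< : ∀ c {a b} → c + a <ᴿ c + b → a <ᴿ b
  +-cancelˡ-< c {a} {b} p =
    <-via (diff p) (solve 3 (λ a b c → (c :+ b) :- (c :+ a) := b :- a) refl a b c)

  neg-anti-< : ∀ {a b} → a <ᴿ b → - b <ᴿ - a
  neg-anti-< {a} {b} p = <-via (diff p) (solve 2 (λ a b → b :- a := (:- a) :- (:- b)) refl a b)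

  double-mono-< : ∀ {a b} → a <ᴿ b → a + a <ᴿ b + b
  double-mono-< p = +-mono-< p p

  double-cancel-< : ∀ {a b} → a + a <ᴿ b + b → a <ᴿ b
  double-cancel-< {a} {b} p with compare a b
  ... | tri< a<b _ _ = a<b
  ... | tri≈ _ a≈b _ = contradiction p (irrefl (+-cong a≈b a≈b))
  ... | tri> _ _ b<a = contradiction p (asym (double-mono-< b<a))

  -- The field carries only a strict order, so `¬ (b <ᴿ a)` stands for a ≤ b throughout.
  ≮-<-trans : ∀ {a b c} → ¬ (b <ᴿ a) → b <ᴿ c → a <ᴿ c
  ≮-<-trans {a} {b} b≮a b<c with compare a b
  ... | tri< a<b _ _ = <-trans a<b b<c
  ... | tri≈ _ a≈b _ = <-respˡ-≈ (sym a≈b) b<c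
  ... | tri> _ _ b<a = contradiction b<a b≮a

  <-≮-trans : ∀ {a b c} → a <ᴿ b → ¬ (c <ᴿ b) → a <ᴿ c
  <-≮-trans {a} {b} {c} a<b c≮b with compare b c
  ... | tri< b<c _ _ = <-trans a<b b<c
  ... | tri≈ _ b≈c _ = <-respʳ-≈ b≈c a<b
  ... | tri> _ _ c<b = contradiction c<b c≮b

  ≉⇒<⊎> : ∀ {a b} → ¬ (a ≈ b) → a <ᴿ b ⊎ b <ᴿ a
  ≉⇒<⊎> {a} {b} a≉b with compare a b
  ... | tri< a<b _ _ = inj₁ a<b
  ... | tri≈ _ a≈b _ = contradiction a≈b a≉b
  ... | tri> _ _ b<a = inj₂ b<a

  half : Carrier → Carrier
  half x = x * ½

  half-double : ∀ x → half x + half x ≈ x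
  half-double x = trans
    (solve 2 (λ x h → x :* h :+ x :* h := x :* ((con (+ 1) :+ con (+ 1)) :* h)) refl x ½)
    -- The solver reads `con (+ 1)` as `1# + 0#`, hence the calls of `+-identityʳ 1#`.
    (trans (*-congˡ (trans (*-congʳ (+-cong (+-identityʳ 1#) (+-identityʳ 1#)))
                           (proj₂ (inverse (1# + 1#) 2≉0))))
           (*-identityʳ x))

  half-pos : ∀ {x} → 0# <ᴿ x → 0# <ᴿ half x
  half-pos {x} 0<x =
    double-cancel-< (<-resp₂ (sym (+-identityʳ 0#)) (sym (half-double x)) 0<x)

  dense : ∀ {a b} → a <ᴿ b → ∃ λ c → a <ᴿ c × c <ᴿ b
  dense {a} {b} a<b = half (a + b)
    , double-cancel-< (<-respʳ-≈ (sym (half-double (a + b))) (+-monoʳ-< a a<b))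
    , double-cancel-< (<-respˡ-≈ (sym (half-double (a + b))) (+-monoˡ-< b a<b))

  dense-below-both : ∀ {a b c} → a <ᴿ b → a <ᴿ c → ∃ λ t → a <ᴿ t × t <ᴿ b × t <ᴿ c
  dense-below-both {a} {b} {c} a<b a<c with b <? c
  ... | yes b<c with t , a<t , t<b ← dense a<b = t , a<t , t<b , <-trans t<b b<c
  ... | no b≮c  with t , a<t , t<c ← dense a<c = t , a<t , <-≮-trans t<c b≮c , t<c

  x<x+pos : ∀ {x e} → 0# <ᴿ e → x <ᴿ x + e
  x<x+pos {x} 0<e = <-respˡ-≈ (+-identityʳ x) (+-monoʳ-< x 0<e)

  x<x+1 : ∀ x → x <ᴿ x + 1#
  x<x+1 x = x<x+pos 0<1

  x-1<x : ∀ x → x - 1# <ᴿ x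
  x-1<x x = <-via 0<1 (solve 2 (λ x o → o := x :- (x :- o)) refl x 1#)

  -- Bounds, gaps and cuts of finite families

  strict-upper-bound : ∀ {n} (u : Fin n → Carrier) → ∃ λ z → ∀ i → u i <ᴿ z
  strict-upper-bound {zero}  u = 0# , λ ()
  strict-upper-bound {suc n} u with strict-upper-bound (u ∘ suc)
  ... | z , above with compare (u zero) z
  ... | tri< u₀<z _ _ = z , λ { zero → u₀<z ; (suc i) → above i }
  ... | tri≈ _ u₀≈z _ = z + 1# , λ
    { zero    → <-respˡ-≈ (sym u₀≈z) (x<x+1 z)
    ; (suc i) → <-trans (above i) (x<x+1 z) }
  ... | tri> _ _ z<u₀ = u zero + 1# , λ
    { zero    → x<x+1 (u zero)
    ; (suc i) → <-trans (above i) (<-trans z<u₀ (x<x+1 (u zero))) }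

  strict-lower-bound : ∀ {n} (u : Fin n → Carrier) → ∃ λ z → ∀ i → z <ᴿ u i
  strict-lower-bound u with strict-upper-bound (-_ ∘ u)
  ... | z , above = - z , λ i →
    <-respʳ-≈ (solve 1 (λ x → :- :- x := x) refl (u i)) (neg-anti-< (above i))

  -- Finitely many values cannot accumulate at `b`: a new value between the current `z` and `b` only
  -- moves `z` closer to `b`.
  gap-below : ∀ {n} (u : Fin n → Carrier) b → ∃ λ z → z <ᴿ b × (∀ i → u i <ᴿ b → u i <ᴿ z)
  gap-below {zero}  u b = b - 1# , x-1<x b , λ ()
  gap-below {suc n} u b with gap-below (u ∘ suc) b
  ... | z , z<b , gap with u zero <? z | u zero <? b
  ... | yes u₀<z | _        = z , z<b , λ { zero _ → u₀<z ; (suc i) → gap i }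
  ... | no _     | no u₀≮b  = z , z<b , λ { zero p → contradiction p u₀≮b ; (suc i) → gap i }
  ... | no u₀≮z  | yes u₀<b with dense u₀<b
  ... | w , u₀<w , w<b = w , w<b , λ
    { zero _    → u₀<w
    ; (suc i) p → <-trans (<-≮-trans (gap i p) u₀≮z) u₀<w }

  -- The value a joins the family, so that the gap below b also lies above a.
  avoid : ∀ {n} (u : Fin n → Carrier) {a b} → a <ᴿ b →
          ∃ λ z → a <ᴿ z × z <ᴿ b × (∀ i → u i <ᴿ z ⊎ z <ᴿ u i)
  avoid u {a} {b} a<b with gap-below (a ∷ u) b
  ... | z , z<b , gap = z , gap zero a<b , z<b , side
    where
    side : ∀ i → u i <ᴿ z ⊎ z <ᴿ u i
    side i with compare (u i) b
    ... | tri< u<b _ _ = inj₁ (gap (suc i) u<b)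
    ... | tri≈ _ u≈b _ = inj₂ (<-respʳ-≈ (sym u≈b) z<b)
    ... | tri> _ _ b<u = inj₂ (<-trans z<b b<u)

  -- A cut of finitely many values is realised by a point. If the bound found so far is not below a
  -- new value `v zero` satisfying `Q`, it moves to a gap just under `v zero`; there it stays above
  -- the `u i` with `P i`, which `lt` places below `v zero`.
  separate : ∀ {n k} (u : Fin n → Carrier) (v : Fin k → Carrier)
             (P : Fin n → Set) (Q : Fin k → Set) (Q? : ∀ j → Dec (Q j)) →
             (∀ i j → P i → Q j → u i <ᴿ v j) →
             ∃ λ z → (∀ i → P i → u i <ᴿ z) × (∀ j → Q j → z <ᴿ v j)
  separate {k = zero} u v P Q Q? lt with strict-upper-bound u
  ... | z , above = z , (λ i _ → above i) , λ ()
  separate {k = suc k} u v P Q Q? lt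
    with separate u (v ∘ suc) P (Q ∘ suc) (Q? ∘ suc) (λ i j → lt i (suc j))
  ... | z , above , below with z <? v zero | Q? zero
  ... | yes z<v | _     = z , above , λ { zero _ → z<v ; (suc j) → below j }
  ... | no _    | no ¬q = z , above , λ { zero q → contradiction q ¬q ; (suc j) → below j }
  ... | no z≮v  | yes q with gap-below u (v zero)
  ... | w , w<v , gap = w , (λ i p → gap i (lt i zero p q)) , λ
    { zero _     → w<v
    ; (suc j) q′ → <-trans (<-≮-trans w<v z≮v) (below j q′) }

  -- Absolute values and comparison of distances

  neg-pos : ∀ {x} → x <ᴿ 0# → 0# <ᴿ - x
  neg-pos {x} x<0 = <-respˡ-≈ (solve 0 (:- con (+ 0) := con (+ 0)) refl) (neg-anti-< x<0)

  abs-upper : ∀ x → ¬ (∣ x ∣ <ᴿ x)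
  abs-upper x p with compare x 0#
  ... | tri< x<0 _ _ = asym x<0 (<-trans (neg-pos x<0) p)
  ... | tri≈ _ _ _   = <-irrefl p
  ... | tri> _ _ _   = <-irrefl p

  abs-upper-neg : ∀ x → ¬ (∣ x ∣ <ᴿ - x)
  abs-upper-neg x p with compare x 0#
  ... | tri< _ _ _   = <-irrefl p
  ... | tri≈ x≮0 x≈0 _ = irrefl (trans x≈0 (trans
          (solve 0 (con (+ 0) := :- con (+ 0)) refl) (-‿cong (sym x≈0)))) p
  ... | tri> x≮0 _ 0<x = <-irrefl (<-trans 0<x (<-trans p (<-respʳ-≈
          (solve 0 (:- con (+ 0) := con (+ 0)) refl) (neg-anti-< 0<x))))

  abs-cases : ∀ (P : Carrier → Set) {x} → P x → P (- x) → P ∣ x ∣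
  abs-cases P {x} Px P-x with compare x 0#
  ... | tri< _ _ _ = P-x
  ... | tri≈ _ _ _ = Px
  ... | tri> _ _ _ = Px

  ∣x∣<z⇒x<z : ∀ {x z} → ∣ x ∣ <ᴿ z → x <ᴿ z
  ∣x∣<z⇒x<z {x} = ≮-<-trans (abs-upper x)

  ∣x∣<z⇒-x<z : ∀ {x z} → ∣ x ∣ <ᴿ z → - x <ᴿ z
  ∣x∣<z⇒-x<z {x} = ≮-<-trans (abs-upper-neg x)

  ∣-∣-<⇒ : ∀ {x y z} → ∣ x - y ∣ <ᴿ z → x <ᴿ y + z × y <ᴿ x + z
  ∣-∣-<⇒ {x} {y} {z} p =
      <-via (diff (∣x∣<z⇒x<z p)) (solve 3 (λ x y z → z :- (x :- y) := (y :+ z) :- x) refl x y z)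
    , <-via (diff (∣x∣<z⇒-x<z p)) (solve 3 (λ x y z → z :- (:- (x :- y)) := (x :+ z) :- y) refl x y z)

  abs-neg : ∀ u → ∣ - u ∣ ≈ ∣ u ∣
  abs-neg u with compare ∣ - u ∣ ∣ u ∣
  ... | tri< p _ _ = contradiction p (abs-cases (λ w → ¬ (∣ - u ∣ <ᴿ w))
          (λ q → abs-upper-neg (- u) (<-respʳ-≈ (solve 1 (λ u → u := :- :- u) refl u) q))
          (abs-upper (- u)))
  ... | tri≈ _ p _ = p
  ... | tri> _ _ p = contradiction p (abs-cases (λ w → ¬ (∣ u ∣ <ᴿ w))
          (abs-upper-neg u)
          (λ q → abs-upper u (<-respʳ-≈ (solve 1 (λ u → :- :- u := u) refl u) q)))

  -- `∣_∣` splits on `compare`, so it does not respect `_≈_` by computation. Instead both strict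
  -- inequalities are refuted: the larger side would be plus or minus its argument, which the other
  -- side bounds.
  abs-cong : ∀ {u v} → u ≈ v → ∣ u ∣ ≈ ∣ v ∣
  abs-cong {u} {v} u≈v with compare ∣ u ∣ ∣ v ∣
  ... | tri< p _ _ = contradiction p (abs-cases (λ w → ¬ (∣ u ∣ <ᴿ w))
          (λ q → abs-upper u (<-respʳ-≈ (sym u≈v) q))
          (λ q → abs-upper-neg u (<-respʳ-≈ (-‿cong (sym u≈v)) q)))
  ... | tri≈ _ p _ = p
  ... | tri> _ _ p = contradiction p (abs-cases (λ w → ¬ (∣ v ∣ <ᴿ w))
          (λ q → abs-upper v (<-respʳ-≈ u≈v q))
          (λ q → abs-upper-neg v (<-respʳ-≈ (-‿cong u≈v) q)))

  -- Both y - a and a - y are below b - y, the first by the midpoint condition and the second by a <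
  -- b, and b - y is at most the distance to b.
  closer-left : ∀ {y a b} → a <ᴿ b → y + y <ᴿ a + b → ∣ y - a ∣ <ᴿ ∣ y - b ∣
  closer-left {y} {a} {b} a<b 2y<a+b = <-≮-trans
    (abs-cases (_<ᴿ - (y - b))
      (<-via (diff 2y<a+b)
        (solve 3 (λ y a b → (a :+ b) :- (y :+ y) := (:- (y :- b)) :- (y :- a)) refl y a b))
      (<-via (diff a<b)
        (solve 3 (λ y a b → b :- a := (:- (y :- b)) :- (:- (y :- a))) refl y a b)))
    (abs-upper-neg (y - b))

  closer-right : ∀ {y a b} → a <ᴿ b → a + b <ᴿ y + y → ∣ y - b ∣ <ᴿ ∣ y - a ∣
  closer-right {y} {a} {b} a<b a+b<2y = <-≮-trans
    (abs-cases (_<ᴿ (y - a))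
      (<-via (diff a<b)
        (solve 3 (λ y a b → b :- a := (y :- a) :- (y :- b)) refl y a b))
      (<-via (diff a+b<2y)
        (solve 3 (λ y a b → (y :+ y) :- (a :+ b) := (y :- a) :- (:- (y :- b))) refl y a b)))
    (abs-upper (y - a))

  equidistant : ∀ {y a b} → y + y ≈ a + b → ∣ y - a ∣ ≈ ∣ y - b ∣
  equidistant {y} {a} {b} 2y≈a+b = trans (abs-cong (trans
    (solve 3 (λ y a b → y :- a := (y :+ y) :+ (:- (y :+ a))) refl y a b)
    (trans (+-congʳ 2y≈a+b)
      (solve 3 (λ y a b → (a :+ b) :+ (:- (y :+ a)) := :- (y :- b)) refl y a b))))
    (abs-neg (y - b))

  left-half : ∀ {y a b} → a <ᴿ b → ∣ y - a ∣ <ᴿ ∣ y - b ∣ → y + y <ᴿ a + b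
  left-half {y} {a} {b} a<b p with compare (y + y) (a + b)
  ... | tri< q _ _ = q
  ... | tri≈ _ q _ = contradiction p (irrefl (equidistant q))
  ... | tri> _ _ q = contradiction p (asym (closer-right a<b q))

  right-half : ∀ {y a b} → a <ᴿ b → ∣ y - b ∣ <ᴿ ∣ y - a ∣ → a + b <ᴿ y + y
  right-half {y} {a} {b} a<b p with compare (y + y) (a + b)
  ... | tri< q _ _ = contradiction p (asym (closer-left a<b q))
  ... | tri≈ _ q _ = contradiction p (irrefl (sym (equidistant q)))
  ... | tri> _ _ q = q

  inverse-pos : ∀ {x} → 0# <ᴿ x → ∃ λ y → 0# <ᴿ y × x * y ≈ 1#
  inverse-pos {x} 0<x with inverse x (λ x≈0 → irrefl (sym x≈0) 0<x)
  ... | y , xy≈1 with compare y 0#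
  ... | tri> _ _ 0<y = y , 0<y , xy≈1
  ... | tri≈ _ y≈0 _ = contradiction 0<1
          (irrefl (trans (sym (zeroʳ x)) (trans (*-congˡ (sym y≈0)) xy≈1)))
  ... | tri< y<0 _ _ = contradiction 0<1 (asym (<-via (*-pos 0<x (neg-pos y<0))
          (trans (solve 2 (λ x y → x :* :- y := :- (x :* y)) refl x y)
            (trans (-‿cong xy≈1) (sym (+-identityˡ (- 1#)))))))

  ∣x∣<z : ∀ {x z} → x <ᴿ z → - x <ᴿ z → ∣ x ∣ <ᴿ z
  ∣x∣<z {z = z} = abs-cases (_<ᴿ z)

  -- (d − w)(M + c) + (d + w)(M − c) = 2(dM − wc).
  product-bound : ∀ {d M w c} → w <ᴿ d → - w <ᴿ d → c <ᴿ M → - c <ᴿ M → w * c <ᴿ d * M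
  product-bound {d} {M} {w} {c} w<d -w<d c<M -c<M = double-cancel-< (<-via
    (+-pos (*-pos (diff w<d) (diff -c<M)) (*-pos (diff -w<d) (diff c<M)))
    (solve 4 (λ d M w c →
        (d :- w) :* (M :- (:- c)) :+ (d :- (:- w)) :* (M :- c) :=
        (d :* M :+ d :* M) :- (w :* c :+ w :* c))
      refl d M w c))

  -- The difference of the two sides is (1 - t)(c - a) + t(d - b). Its two terms are both positive
  -- only for 0 < t < 1, so the endpoints are treated apart.
  interpolate-< : ∀ {a b c d t} → ¬ (t <ᴿ 0#) → ¬ (1# <ᴿ t) → a <ᴿ c → b <ᴿ d →
                  a + t * (b - a) <ᴿ c + t * (d - c)
  interpolate-< {a} {b} {c} {d} {t} t≮0 1≮t a<c b<d with compare t 0# | compare t 1#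
  ... | tri< t<0 _ _ | _ = contradiction t<0 t≮0
  ... | _ | tri> _ _ 1<t = contradiction 1<t 1≮t
  ... | tri≈ _ t≈0 _ | _ = <-resp₂ (at-0 a b) (at-0 c d) a<c
    where
    at-0 : ∀ a b → a ≈ a + t * (b - a)
    at-0 a b = trans (solve 2 (λ a b → a := a :+ con (+ 0) :* (b :- a)) refl a b)
                     (+-congˡ (*-congʳ (sym t≈0)))
  ... | _ | tri≈ _ t≈1 _ = <-resp₂ (at-1 a b) (at-1 c d) b<d
    where
    at-1 : ∀ a b → b ≈ a + t * (b - a)
    at-1 a b = trans (solve 2 (λ a b → b := a :+ con (+ 1) :* (b :- a)) refl a b)
                     (+-congˡ (*-congʳ (trans (+-identityʳ 1#) (sym t≈1))))
  ... | tri> _ _ 0<t | tri< t<1 _ _ = <-via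
    (+-pos (*-pos (diff (<-respʳ-≈ (sym (+-identityʳ 1#)) t<1)) (diff a<c)) (*-pos 0<t (diff b<d)))
    (solve 5 (λ a b c d t →
        (con (+ 1) :- t) :* (c :- a) :+ t :* (d :- b) :=
        (c :+ t :* (d :- c)) :- (a :+ t :* (b :- a)))
      refl a b c d t)

-- Finite combinatorics

module _ where
  open ≡

  expanding : ∀ {m} (f : Fin m → Fin m) → (∀ {k l} → k Fin.< l → f k Fin.< f l) →
              ∀ i → i Fin.≤ f i
  expanding {suc m} f mono = Fin.<-weakInduction (λ i → i Fin.≤ f i) ℕ.z≤n
    (λ i i≤fi → ℕ.≤-<-trans (subst (ℕ._≤ toℕ (f (inject₁ i))) (Fin.toℕ-inject₁ i) i≤fi)
      (mono (ℕ.s≤s (ℕ.≤-reflexive (Fin.toℕ-inject₁ i)))))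

  flip-monotone : ∀ {m} (π : Permutation′ m) →
                  (∀ {k l} → k Fin.< l → (π ⟨$⟩ʳ k) Fin.< (π ⟨$⟩ʳ l)) →
                  ∀ {i j} → i Fin.< j → (π ⟨$⟩ˡ i) Fin.< (π ⟨$⟩ˡ j)
  flip-monotone π mono {i} {j} i<j with Fin.<-cmp (π ⟨$⟩ˡ i) (π ⟨$⟩ˡ j)
  ... | tri< p _ _ = p
  ... | tri≈ _ p _ = contradiction i<j (Fin.<-irrefl
          (trans (sym (inverseʳ π)) (trans (cong (π ⟨$⟩ʳ_) p) (inverseʳ π))))
  ... | tri> _ _ p = contradiction i<j (Fin.<-asym (subst₂ Fin._<_ (inverseʳ π) (inverseʳ π) (mono p)))

  -- The inverse is monotone as well, and both maps are expanding; the inverse, applied at π i,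
  -- yields π i ≤ i.
  monotone⇒id : ∀ {m} (π : Permutation′ m) →
                (∀ {k l} → k Fin.< l → (π ⟨$⟩ʳ k) Fin.< (π ⟨$⟩ʳ l)) → π ≈ₚ idₚ
  monotone⇒id π mono i = Fin.≤-antisym
    (subst (λ j → (π ⟨$⟩ʳ i) Fin.≤ j) (inverseˡ π)
      (expanding (π ⟨$⟩ˡ_) (flip-monotone π mono) (π ⟨$⟩ʳ i)))
    (expanding (π ⟨$⟩ʳ_) mono i)

  opposite-anti : ∀ {m} {i j : Fin m} → i Fin.< j → opposite j Fin.< opposite i
  opposite-anti {i = i} {j} i<j = subst₂ ℕ._<_
    (sym (Fin.opposite-prop j)) (sym (Fin.opposite-prop i))
    (ℕ.∸-monoʳ-< (ℕ.s≤s i<j) (Fin.toℕ<n j))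

  -- Enumeration of permutations, and other finite tools

  prepend : ∀ {m} {A : Set} → (A → Permutation′ m) → Fin (suc m) × A → Permutation′ (suc m)
  prepend p (j , a) = insert zero j (p a)

  -- Factorial number system: the leading digit is the image of `zero`, and the remainder encodes
  -- the permutation of the other indices.
  permutations : ∀ m → Fin (m !) → Permutation′ m
  permutations zero    _ = idₚ
  permutations (suc m) a = prepend (permutations m) (remQuot (m !) a)

  insert-zero-suc : ∀ {m} j (π : Permutation′ m) k →
                    insert zero j π ⟨$⟩ʳ suc k ≡ punchIn j (π ⟨$⟩ʳ k)
  insert-zero-suc j π k = insert-punchIn zero j π k

  insert-zero-cong : ∀ {m} j {π ρ : Permutation′ m} → π ≈ₚ ρ → insert zero j π ≈ₚ insert zero j ρ
  insert-zero-cong j π≈ρ zero    = refl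
  insert-zero-cong j {π} {ρ} π≈ρ (suc k) = trans (insert-zero-suc j π k)
    (trans (cong (punchIn j) (π≈ρ k)) (sym (insert-zero-suc j ρ k)))

  insert-zero-injective : ∀ {m} {i j} {π ρ : Permutation′ m} →
                          insert zero i π ≈ₚ insert zero j ρ → i ≡ j × π ≈ₚ ρ
  insert-zero-injective {i = i} {π = π} {ρ} eq with eq zero
  ... | refl = refl , λ k → Fin.punchIn-injective i _ _
    (trans (sym (insert-zero-suc i π k)) (trans (eq (suc k)) (insert-zero-suc i ρ k)))

  permutations-injective : ∀ m {a b} → permutations m a ≈ₚ permutations m b → a ≡ b
  permutations-injective zero {zero} {zero} _ = refl
  permutations-injective (suc m) {a} {b} eq
    with i≡j , rest ← insert-zero-injective
           {π = permutations m (proj₂ (remQuot {suc m} (m !) a))}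
           {ρ = permutations m (proj₂ (remQuot {suc m} (m !) b))} eq = begin
    a                                           ≡⟨ Fin.combine-remQuot {suc m} (m !) a ⟨
    uncurry combine (remQuot {suc m} (m !) a)   ≡⟨ cong₂ combine i≡j (permutations-injective m rest) ⟩
    uncurry combine (remQuot {suc m} (m !) b)   ≡⟨ Fin.combine-remQuot {suc m} (m !) b ⟩
    b                                           ∎
    where open ≡-Reasoning

  permutations-surjective : ∀ m (π : Permutation′ m) → ∃ λ a → permutations m a ≈ₚ π
  permutations-surjective zero    π = zero , λ ()
  permutations-surjective (suc m) π
    with a , eq ← permutations-surjective m (remove zero π) =
      combine (π ⟨$⟩ʳ zero) a , λ k → begin
        permutations (suc m) (combine (π ⟨$⟩ʳ zero) a) ⟨$⟩ʳ k
          ≡⟨ cong (λ q → prepend (permutations m) q ⟨$⟩ʳ k) (Fin.remQuot-combine (π ⟨$⟩ʳ zero) a) ⟩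
        insert zero (π ⟨$⟩ʳ zero) (permutations m a) ⟨$⟩ʳ k
          ≡⟨ insert-zero-cong (π ⟨$⟩ʳ zero) {permutations m a} {remove zero π} eq k ⟩
        insert zero (π ⟨$⟩ʳ zero) (remove zero π) ⟨$⟩ʳ k
          ≡⟨ insert-remove zero π k ⟩
        π ⟨$⟩ʳ k ∎
    where open ≡-Reasoning

  -- Adding a third coordinate to both sides turns a comparison of two coordinates into one of
  -- midpoints; this is how 3 ≤ m is used.
  third-index : ∀ {m} → 3 ℕ.≤ m → (i j : Fin m) → ∃ λ k → k ≢ i × k ≢ j
  third-index (ℕ.s≤s (ℕ.s≤s (ℕ.s≤s _))) zero          zero          = suc zero , (λ ()) , λ ()
  third-index (ℕ.s≤s (ℕ.s≤s (ℕ.s≤s _))) zero          (suc zero)    = suc (suc zero) , (λ ()) , λ ()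
  third-index (ℕ.s≤s (ℕ.s≤s (ℕ.s≤s _))) zero          (suc (suc j)) = suc zero , (λ ()) , λ ()
  third-index (ℕ.s≤s (ℕ.s≤s (ℕ.s≤s _))) (suc zero)    zero          = suc (suc zero) , (λ ()) , λ ()
  third-index (ℕ.s≤s (ℕ.s≤s (ℕ.s≤s _))) (suc (suc i)) zero          = suc zero , (λ ()) , λ ()
  third-index (ℕ.s≤s (ℕ.s≤s (ℕ.s≤s _))) (suc i)       (suc j)       = zero , (λ ()) , λ ()

  no-four-distinct : ∀ {i j k l : Fin 3} →
                     i ≢ j → i ≢ k → i ≢ l → j ≢ k → j ≢ l → k ≢ l → ∀ {A : Set} → A
  no-four-distinct {i} {j} {k} {l} ij ik il jk jl kl
    with Fin.pigeonhole (ℕ.n<1+n 3) (i ∷ j ∷ k ∷ l ∷ [])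
  ... | zero             , suc zero             , _ , p = contradiction p ij
  ... | zero             , suc (suc zero)       , _ , p = contradiction p ik
  ... | zero             , suc (suc (suc zero)) , _ , p = contradiction p il
  ... | suc zero         , suc (suc zero)       , _ , p = contradiction p jk
  ... | suc zero         , suc (suc (suc zero)) , _ , p = contradiction p jl
  ... | suc (suc zero)   , suc (suc (suc zero)) , _ , p = contradiction p kl
  ... | suc zero         , suc zero             , ℕ.s≤s () , _
  ... | suc (suc _)      , suc zero             , ℕ.s≤s () , _
  ... | suc (suc zero)   , suc (suc zero)       , ℕ.s≤s (ℕ.s≤s ()) , _
  ... | suc (suc (suc zero)) , suc (suc zero)   , ℕ.s≤s (ℕ.s≤s ()) , _
  ... | suc (suc (suc zero)) , suc (suc (suc zero)) , ℕ.s≤s (ℕ.s≤s (ℕ.s≤s ())) , _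

  -- `_/_` normalises, so the equality is obtained from unnormalised rationals, where it is cross
  -- multiplication.
  /-cross : ∀ a b c d .{{_ : NonZero b}} .{{_ : NonZero d}} → a ℕ.* d ≡ c ℕ.* b → + a / b ≡ + c / d
  /-cross a (suc b) c (suc d) eq = ℚ.fromℚᵘ-cong {mkℚᵘ (+ a) b} {mkℚᵘ (+ c) d} (*≡* (begin
    + a ℤ.* + suc d    ≡⟨ ℤ.pos-* a (suc d) ⟨
    + (a ℕ.* suc d)    ≡⟨ cong +_ eq ⟩
    + (c ℕ.* suc b)    ≡⟨ ℤ.pos-* c (suc b) ⟩
    + c ℤ.* + suc b    ∎))
    where
    open ≡-Reasoning

  -- The first test splits `A` into two parts, and the remaining tests are treated on each. Excluded
  -- middle decides on which part an element lies and, once no test is left, whether the part is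
  -- inhabited.
  representatives : ExcludedMiddle 0ℓ → ∀ {A : Set} N (T : Fin N → A → Set) →
    ∃ λ n → ∃ λ (e : Fin n → A) →
      (∀ i j → (∀ t → T t (e i) ⇔ T t (e j)) → i ≡ j) ×
      (∀ a → ∃ λ i → ∀ t → T t (e i) ⇔ T t a)
  representatives em {A} zero T with em {A}
  ... | yes a = 1 , (λ _ → a) , (λ { zero zero _ → refl }) , λ _ → zero , λ ()
  ... | no ¬a = 0 , (λ ()) , (λ ()) , λ a → contradiction a ¬a
  representatives em {A} (suc N) T
    with n₁ , e₁ , inj-e₁ , sur-e₁ ← representatives em {Σ A (T zero)} N (λ t → T (suc t) ∘ proj₁)
       | n₂ , e₂ , inj-e₂ , sur-e₂ ← representatives em {Σ A (¬_ ∘ T zero)} N (λ t → T (suc t) ∘ proj₁)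
    = n₁ ℕ.+ n₂ , e ∘ splitAt n₁
    , (λ i j eq → begin
        i                            ≡⟨ Fin.join-splitAt n₁ n₂ i ⟨
        join n₁ n₂ (splitAt n₁ i)    ≡⟨ cong (join n₁ n₂) (inj-e (splitAt n₁ i) (splitAt n₁ j) eq) ⟩
        join n₁ n₂ (splitAt n₁ j)    ≡⟨ Fin.join-splitAt n₁ n₂ j ⟩
        j                            ∎)
    , λ a → let s , eq = sur-e a in
        join n₁ n₂ s , subst (λ s → ∀ t → T t (e s) ⇔ T t a) (sym (Fin.splitAt-join n₁ n₂ s)) eq
    where
    open ≡-Reasoning
    open Equivalence

    e : Fin n₁ ⊎ Fin n₂ → A
    e = [ proj₁ ∘ e₁ , proj₁ ∘ e₂ ]′

    inj-e : ∀ s s′ → (∀ t → T t (e s) ⇔ T t (e s′)) → s ≡ s′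
    inj-e (inj₁ i) (inj₁ j) eq = cong inj₁ (inj-e₁ i j (eq ∘ suc))
    inj-e (inj₁ i) (inj₂ j) eq = contradiction (to (eq zero) (proj₂ (e₁ i))) (proj₂ (e₂ j))
    inj-e (inj₂ i) (inj₁ j) eq = contradiction (from (eq zero) (proj₂ (e₁ j))) (proj₂ (e₂ i))
    inj-e (inj₂ i) (inj₂ j) eq = cong inj₂ (inj-e₂ i j (eq ∘ suc))

    sur-e : ∀ a → ∃ λ s → ∀ t → T t (e s) ⇔ T t a
    sur-e a with em {T zero a}
    ... | yes p with i , eq ← sur-e₁ (a , p) =
      inj₁ i , λ { zero → mk⇔ (λ _ → p) (λ _ → proj₂ (e₁ i)) ; (suc t) → eq t }
    ... | no ¬p with i , eq ← sur-e₂ (a , ¬p) =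
      inj₂ i , λ { zero → mk⇔ (λ q → contradiction q (proj₂ (e₂ i))) (λ q → contradiction q ¬p)
                 ; (suc t) → eq t }

-- Midpoint orders and ranking patterns

module MidpointOrders (ℝ : CompleteOrderedField) where
  open CompleteOrderedField ℝ
  open Euclidean ℝ
  open RankingPatterns ℝ
  open OrderedField ℝ
  open CommutativeRing commutativeRing using (refl; sym; trans; +-congʳ; +-cong; +-comm; *-congʳ)
  open IsStrictTotalOrder isStrictTotalOrder
    using (compare; _<?_; irrefl; asym; <-respˡ-≈; <-respʳ-≈) renaming (trans to <-trans)
  open IntegerRingSolver commutativeRing

  module _ {m : ℕ} where

    -- For points with distinct midpoints this is symmetric and says that corresponding
    -- midpoints are ordered alike.
    Same : Rel (Point m) 0ℓ
    Same x x′ = ∀ {i j k l} → i ≢ j → k ≢ l →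
                x i + x j <ᴿ x k + x l → x′ i + x′ j <ᴿ x′ k + x′ l

    SamePair : (i j k l : Fin m) → Set
    SamePair i j k l = (i ≡ k × j ≡ l) ⊎ (i ≡ l × j ≡ k)

    -- Genericity in terms of unordered pairs and doubled midpoints, a form stable under relabelling
    -- and reflection.
    DistinctMidpoints : Pred (Point m) 0ℓ
    DistinctMidpoints x = ∀ {i j k l} → i ≢ j → k ≢ l → x i + x j ≈ x k + x l → SamePair i j k l

    Distinct : Pred (Point m) 0ℓ
    Distinct x = ∀ {i j} → i ≢ j → ¬ (x i ≈ x j)

    SamePair⇒≈ : ∀ (x : Point m) {i j k l} → SamePair i j k l → x i + x j ≈ x k + x l
    SamePair⇒≈ x (inj₁ (≡.refl , ≡.refl)) = refl
    SamePair⇒≈ x (inj₂ (≡.refl , ≡.refl)) = +-comm _ _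

    ordered : ∀ {i j : Fin m} → i ≢ j → i Fin.< j ⊎ j Fin.< i
    ordered {i} {j} i≢j with Fin.<-cmp i j
    ... | tri< p _ _ = inj₁ p
    ... | tri≈ _ p _ = contradiction p i≢j
    ... | tri> _ _ p = inj₂ p

    Generic⇒DistinctMidpoints : ∀ {x : Point m} → Generic x → DistinctMidpoints x
    Generic⇒DistinctMidpoints {x} g {i} {j} {k} {l} i≢j k≢l eq with ordered i≢j | ordered k≢l
    ... | inj₁ i<j | inj₁ k<l = inj₁ (g i<j k<l (*-congʳ eq))
    ... | inj₁ i<j | inj₂ l<k = inj₂ (g i<j l<k (*-congʳ (trans eq (+-comm _ _))))
    ... | inj₂ j<i | inj₁ k<l with j≡k , i≡l ← g j<i k<l (*-congʳ (trans (+-comm _ _) eq)) =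
      inj₂ (i≡l , j≡k)
    ... | inj₂ j<i | inj₂ l<k
      with j≡l , i≡k ← g j<i l<k (*-congʳ (trans (+-comm _ _) (trans eq (+-comm _ _)))) =
      inj₁ (i≡k , j≡l)

    DistinctMidpoints⇒Generic : ∀ {x : Point m} → DistinctMidpoints x → Generic x
    DistinctMidpoints⇒Generic {x} d {i} {j} {k} {l} i<j k<l eq
      with d (Fin.<⇒≢ i<j) (Fin.<⇒≢ k<l)
             (trans (sym (half-double _)) (trans (+-cong eq eq) (half-double _)))
    ... | inj₁ p = p
    ... | inj₂ (≡.refl , ≡.refl) = contradiction k<l (Fin.<-asym i<j)

    DistinctMidpoints⇒Distinct : 3 ℕ.≤ m → ∀ {x : Point m} → DistinctMidpoints x → Distinct x
    DistinctMidpoints⇒Distinct 3≤m d {i} {j} i≢j xi≈xj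
      with k , k≢i , k≢j ← third-index 3≤m i j
      with d (k≢i ∘ ≡.sym) (k≢j ∘ ≡.sym) (+-congʳ xi≈xj)
    ... | inj₁ (i≡j , _) = i≢j i≡j
    ... | inj₂ (i≡k , _) = k≢i (≡.sym i≡k)

    module _ {x : Point m} (off : Arrangement.complement (𝓜 m) x) where

      off⇒Distinct : Distinct x
      off⇒Distinct i≢j eq with ordered i≢j
      ... | inj₁ i<j = off (inj₁ (mk _ _ i<j)) eq
      ... | inj₂ j<i = off (inj₁ (mk _ _ j<i)) (sym eq)

      private
        -- `MidIndex` lists an equation only with the least index first, so the two sides are
        -- exchanged when k < i.
        off-sorted : ∀ {i j k l} → i ≢ k → i ≢ l → j ≢ k → j ≢ l → i Fin.< j → k Fin.< l →
                     ¬ (x i + x j ≈ x k + x l)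
        off-sorted i≢k i≢l j≢k j≢l i<j k<l eq with ordered i≢k
        ... | inj₁ i<k = off (inj₂ (mk _ _ _ _ (Fin.<⇒≢ i<j) i≢k i≢l j≢k j≢l (Fin.<⇒≢ k<l)
                                      i<j i<k k<l)) eq
        ... | inj₂ k<i = off (inj₂ (mk _ _ _ _ (Fin.<⇒≢ k<l) (i≢k ∘ ≡.sym) (j≢k ∘ ≡.sym)
                                      (i≢l ∘ ≡.sym) (j≢l ∘ ≡.sym) (Fin.<⇒≢ i<j)
                                      k<l k<i i<j)) (sym eq)

        off-disjoint : ∀ {i j k l} → i ≢ j → i ≢ k → i ≢ l → j ≢ k → j ≢ l → k ≢ l →
                       ¬ (x i + x j ≈ x k + x l)
        off-disjoint i≢j i≢k i≢l j≢k j≢l k≢l eq with ordered i≢j | ordered k≢l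
        ... | inj₁ i<j | inj₁ k<l = off-sorted i≢k i≢l j≢k j≢l i<j k<l eq
        ... | inj₁ i<j | inj₂ l<k = off-sorted i≢l i≢k j≢l j≢k i<j l<k (trans eq (+-comm _ _))
        ... | inj₂ j<i | inj₁ k<l = off-sorted j≢k j≢l i≢k i≢l j<i k<l (trans (+-comm _ _) eq)
        ... | inj₂ j<i | inj₂ l<k =
          off-sorted j≢l j≢k i≢l i≢k j<i l<k (trans (+-comm _ _) (trans eq (+-comm _ _)))

        cancelˡ : ∀ {a b c} → a + b ≈ a + c → b ≈ c
        cancelˡ {a} {b} {c} eq with compare b c
        ... | tri< p _ _ = contradiction (+-monoʳ-< a p) (irrefl eq)
        ... | tri≈ _ p _ = p
        ... | tri> _ _ p = contradiction (+-monoʳ-< a p) (irrefl (sym eq))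

        equal-partners : ∀ {a j l} → x a + x j ≈ x a + x l → j ≡ l
        equal-partners {j = j} {l} eq with j Fin.≟ l
        ... | yes p = p
        ... | no j≢l = contradiction (cancelˡ eq) (off⇒Distinct j≢l)

      -- A shared index cancels and leaves an equality of two coordinates, which the braid
      -- hyperplanes exclude; disjoint pairs are left to the mid-hyperplanes.
      off⇒DistinctMidpoints : DistinctMidpoints x
      off⇒DistinctMidpoints {i} {j} {k} {l} i≢j k≢l eq
        with i Fin.≟ k | i Fin.≟ l | j Fin.≟ k | j Fin.≟ l
      ... | yes ≡.refl | _ | _ | _ = inj₁ (≡.refl , equal-partners eq)
      ... | no _ | yes ≡.refl | _ | _ = inj₂ (≡.refl , equal-partners (trans eq (+-comm _ _)))
      ... | no _ | no _ | yes ≡.refl | _ = inj₂ (equal-partners (trans (+-comm _ _) eq) , ≡.refl)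
      ... | no _ | no _ | no _ | yes ≡.refl =
        inj₁ (equal-partners (trans (+-comm _ _) (trans eq (+-comm _ _))) , ≡.refl)
      ... | no i≢k | no i≢l | no j≢k | no j≢l =
        contradiction eq (off-disjoint i≢j i≢k i≢l j≢k j≢l k≢l)

    DistinctMidpoints⇒off : 3 ℕ.≤ m → ∀ {x : Point m} → DistinctMidpoints x →
                            Arrangement.complement (𝓜 m) x
    DistinctMidpoints⇒off 3≤m d (inj₁ (mk i j i<j)) eq =
      DistinctMidpoints⇒Distinct 3≤m d (Fin.<⇒≢ i<j) eq
    DistinctMidpoints⇒off 3≤m d (inj₂ (mk i j k l i≢j i≢k i≢l _ _ k≢l _ _ _)) eq
      with d i≢j k≢l eq
    ... | inj₁ (i≡k , _) = i≢k i≡k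
    ... | inj₂ (i≡l , _) = i≢l i≡l

    Same-sym : ∀ {x x′ : Point m} → DistinctMidpoints x → Same x x′ → Same x′ x
    Same-sym {x} {x′} d same {i} {j} {k} {l} i≢j k≢l p with compare (x i + x j) (x k + x l)
    ... | tri< q _ _ = q
    ... | tri≈ _ q _ = contradiction p (irrefl (SamePair⇒≈ x′ (d i≢j k≢l q)))
    ... | tri> _ _ q = contradiction p (asym (same k≢l i≢j q))

    Same-trans : ∀ {x y z : Point m} → Same x y → Same y z → Same x z
    Same-trans p q i≢j k≢l = q i≢j k≢l ∘ p i≢j k≢l

    Same⇒order : 3 ℕ.≤ m → ∀ {x x′ : Point m} → Same x x′ → ∀ {i j} → x i <ᴿ x j → x′ i <ᴿ x′ j
    Same⇒order 3≤m {x} {x′} same {i} {j} p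
      with k , k≢i , k≢j ← third-index 3≤m i j =
      +-cancelʳ-< (x′ k) (same (k≢i ∘ ≡.sym) (k≢j ∘ ≡.sym) (+-monoˡ-< (x k) p))

    Increasing⇒order : ∀ {x : Point m} → Increasing x → ∀ {i j} → x i <ᴿ x j → i Fin.< j
    Increasing⇒order inc {i} {j} p with Fin.<-cmp i j
    ... | tri< q _ _ = q
    ... | tri≈ _ ≡.refl _ = contradiction p <-irrefl
    ... | tri> _ _ q = contradiction p (asym (inc q))

    infixl 8 _∘ᵖ_
    _∘ᵖ_ : Point m → Permutation′ m → Point m
    (x ∘ᵖ π) i = x (π ⟨$⟩ʳ i)

    ⟨$⟩ʳ-injective : ∀ (π : Permutation′ m) {i j} → (π ⟨$⟩ʳ i) ≡ (π ⟨$⟩ʳ j) → i ≡ j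
    ⟨$⟩ʳ-injective π eq = ≡.trans (≡.sym (inverseˡ π)) (≡.trans (≡.cong (π ⟨$⟩ˡ_) eq) (inverseˡ π))

    ⟨$⟩ʳ-≢ : ∀ (π : Permutation′ m) {i j} → i ≢ j → (π ⟨$⟩ʳ i) ≢ (π ⟨$⟩ʳ j)
    ⟨$⟩ʳ-≢ π i≢j = i≢j ∘ ⟨$⟩ʳ-injective π

    DistinctMidpoints-∘ᵖ : ∀ {x : Point m} π → DistinctMidpoints x → DistinctMidpoints (x ∘ᵖ π)
    DistinctMidpoints-∘ᵖ π d i≢j k≢l eq = Sum.map inj inj (d (⟨$⟩ʳ-≢ π i≢j) (⟨$⟩ʳ-≢ π k≢l) eq)
      where
      inj : ∀ {i j k l} → (π ⟨$⟩ʳ i) ≡ (π ⟨$⟩ʳ k) × (π ⟨$⟩ʳ j) ≡ (π ⟨$⟩ʳ l) → i ≡ k × j ≡ l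
      inj (p , q) = ⟨$⟩ʳ-injective π p , ⟨$⟩ʳ-injective π q

    Same-∘ᵖ : ∀ {x x′ : Point m} π → Same x x′ → Same (x ∘ᵖ π) (x′ ∘ᵖ π)
    Same-∘ᵖ π same i≢j k≢l = same (⟨$⟩ʳ-≢ π i≢j) (⟨$⟩ʳ-≢ π k≢l)

    reflect : Point m → Point m
    reflect x i = - x (opposite i)

    neg-cancel : ∀ {a b} → - a ≈ - b → a ≈ b
    neg-cancel {a} {b} eq with compare a b
    ... | tri< p _ _ = contradiction (neg-anti-< p) (irrefl (sym eq))
    ... | tri≈ _ p _ = p
    ... | tri> _ _ p = contradiction (neg-anti-< p) (irrefl eq)

    neg-+ : ∀ a b → - a + - b ≈ - (a + b)
    neg-+ = solve 2 (λ a b → :- a :+ :- b := :- (a :+ b)) refl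

    neg-+-anti : ∀ {a b c d} → a + b <ᴿ c + d → - c + - d <ᴿ - a + - b
    neg-+-anti p = <-resp₂ (sym (neg-+ _ _)) (sym (neg-+ _ _)) (neg-anti-< p)

    DistinctMidpoints-reflect : ∀ {x : Point m} → DistinctMidpoints x → DistinctMidpoints (reflect x)
    DistinctMidpoints-reflect {x} d = DistinctMidpoints-∘ᵖ {λ i → - x i} reverseₚ
      (λ i≢j k≢l eq → d i≢j k≢l (neg-cancel (trans (sym (neg-+ _ _)) (trans eq (neg-+ _ _)))))

    Increasing-reflect : ∀ {x : Point m} → Increasing x → Increasing (reflect x)
    Increasing-reflect inc i<j = neg-anti-< (inc (opposite-anti i<j))

    Same-reflect : ∀ {x x′ : Point m} → Same x x′ → Same (reflect x) (reflect x′)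
    Same-reflect {x} {x′} same = Same-∘ᵖ {λ i → - x i} {λ i → - x′ i} reverseₚ
      (λ i≢j k≢l p → neg-+-anti (same k≢l i≢j (neg-+-cancel p)))
      where
      neg-+-cancel : ∀ {a b c d} → - c + - d <ᴿ - a + - b → a + b <ᴿ c + d
      neg-+-cancel {a} {b} {c} {d} p = <-via (diff p)
        (solve 4 (λ a b c d → (:- a :+ :- b) :- (:- c :+ :- d) := (c :+ d) :- (a :+ b)) refl a b c d)

  least : ∀ {m} (x : Point (suc m)) → Distinct x → ∃ λ i → ∀ {k} → i ≢ k → x i <ᴿ x k
  least {zero}  x dist = zero , λ { {zero} p → contradiction ≡.refl p }
  least {suc m} x dist
    with i , below ← least (x ∘ suc) (λ p → dist (p ∘ Fin.suc-injective))
    with compare (x zero) (x (suc i))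
  ... | tri≈ _ p _ = contradiction p (dist λ ())
  ... | tri> _ _ p = suc i , λ
    { {zero}  _ → p
    ; {suc k} q → below (q ∘ ≡.cong suc) }
  ... | tri< p _ _ = zero , below₀
    where
    below₀ : ∀ {k} → zero ≢ k → x zero <ᴿ x k
    below₀ {zero}  q = contradiction ≡.refl q
    below₀ {suc k} _ with i Fin.≟ k
    ... | yes ≡.refl = p
    ... | no i≢k     = <-trans p (below i≢k)

  -- Selection sort: the least coordinate goes to position `zero`, the others are sorted
  -- recursively.
  sort : ∀ {m} (x : Point m) → Distinct x → ∃ λ π → Increasing (x ∘ᵖ π)
  sort {zero}  x dist = idₚ , λ { {()} }
  sort {suc m} x dist
    with i , below ← least x dist
    with π , inc ← sort (x ∘ punchIn i) (λ p → dist (p ∘ Fin.punchIn-injective i _ _)) =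
      insert zero i π , λ
        { {zero}  {suc l} _ → ≡.subst (λ a → x i <ᴿ x a) (≡.sym (insert-zero-suc i π l))
                                (below (Fin.punchInᵢ≢i i _ ∘ ≡.sym))
        ; {suc k} {suc l} (ℕ.s≤s k<l) → ≡.subst₂ (λ a b → x a <ᴿ x b)
                                (≡.sym (insert-zero-suc i π k)) (≡.sym (insert-zero-suc i π l)) (inc k<l) }

  -- Ranking patterns and midpoint orders

  module _ {m : ℕ} where

    SortedBy : Permutation′ m → Pred (Fin m → Carrier) 0ℓ
    SortedBy π d = Increasing (d ∘ᵖ π)

    transfer : ∀ π {d d′} → SortedBy π d → SortedBy π d′ → ∀ {i j} → d i <ᴿ d j → d′ i <ᴿ d′ j
    transfer π {d} {d′} s s′ {i} {j} p = ≡.subst₂ (λ a b → d′ a <ᴿ d′ b) (inverseʳ π) (inverseʳ π)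
      (s′ (Increasing⇒order {x = d ∘ᵖ π} s
        (≡.subst₂ (λ a b → d a <ᴿ d b) (≡.sym (inverseʳ π)) (≡.sym (inverseʳ π)) p)))

    private
      -- Pairs are coded in `Fin (m * m)`, so that the results on singly indexed finite families
      -- apply to midpoints.
      pairwise : ∀ (P : Fin m × Fin m → Set) → (∀ c → P (remQuot m c)) → ∀ i j → P (i , j)
      pairwise P f i j = ≡.subst P (Fin.remQuot-combine i j) (f (combine i j))

      separate₂ : (u : Fin m → Fin m → Carrier) (P Q : Fin m → Fin m → Set) →
                  (∀ i j → Dec (Q i j)) →
                  (∀ {i j k l} → P i j → Q k l → u i j <ᴿ u k l) →
                  ∃ λ z → (∀ i j → P i j → u i j <ᴿ z) × (∀ i j → Q i j → z <ᴿ u i j)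
      separate₂ u P Q Q? lt
        with z , above , below ← separate (uncurry u ∘ remQuot m) (uncurry u ∘ remQuot m)
               (uncurry P ∘ remQuot m) (uncurry Q ∘ remQuot m)
               (λ c → uncurry Q? (remQuot m c)) (λ _ _ → lt) =
          z , pairwise (λ (i , j) → P i j → u i j <ᴿ z) above
            , pairwise (λ (i , j) → Q i j → z <ᴿ u i j) below

      avoid₂ : (u : Fin m → Fin m → Carrier) → ∀ {a b} → a <ᴿ b →
               ∃ λ z → a <ᴿ z × z <ᴿ b × (∀ i j → u i j <ᴿ z ⊎ z <ᴿ u i j)
      avoid₂ u a<b with z , a<z , z<b , side ← avoid (uncurry u ∘ remQuot m) a<b =
        z , a<z , z<b , pairwise (λ (i , j) → u i j <ᴿ z ⊎ z <ᴿ u i j) side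

    -- The viewpoint `y` cuts the midpoints of `x` in two. By `same`, the corresponding classes of
    -- midpoints of `x′` still lie one before the other, so some point cuts them in the same way and
    -- sees the same ranking. The cut `z` is on the scale of doubled midpoints, hence the viewpoint
    -- `half z`.
    Same⇒RP⊆ : ∀ {x x′ : Point m} → Increasing x → Increasing x′ → Same x x′ → RP x ⊆ RP x′
    Same⇒RP⊆ {x} {x′} inc inc′ same {π} (y , s)
      with z , left , right ← separate₂ (λ i j → x′ i + x′ j)
             (λ i j → i Fin.< j × x i + x j <ᴿ y + y)
             (λ i j → i Fin.< j × y + y <ᴿ x i + x j)
             (λ i j → (i Fin.<? j) ×-dec (y + y <? x i + x j))
             (λ (i<j , p) (k<l , q) → same (Fin.<⇒≢ i<j) (Fin.<⇒≢ k<l) (<-trans p q)) =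
        half z , sorted
      where
      sorted : SortedBy π (λ i → ∣ half z - x′ i ∣)
      sorted {k} {l} k<l with ordered (⟨$⟩ʳ-≢ π (Fin.<⇒≢ k<l))
      ... | inj₁ a<b = closer-left (inc′ a<b) (<-respˡ-≈ (sym (half-double z))
              (right _ _ (a<b , left-half (inc a<b) (s k<l))))
      ... | inj₂ b<a = closer-right (inc′ b<a) (<-respʳ-≈ (sym (half-double z))
              (left _ _ (b<a , right-half (inc b<a) (s k<l))))

    Same⇒RP≐ : ∀ {x x′ : Point m} → Increasing x → Increasing x′ → DistinctMidpoints x →
               Same x x′ → RP x ≐ RP x′
    Same⇒RP≐ {x} {x′} inc inc′ d same =
        (λ {π} → Same⇒RP⊆ {x} {x′} inc inc′ same {π})
      , (λ {π} → Same⇒RP⊆ {x′} {x} inc′ inc (Same-sym {x = x} {x′} d same) {π})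

    distances-distinct : ∀ {x : Point m} → Increasing x → ∀ {z} →
                         (∀ i j → x i + x j <ᴿ z ⊎ z <ᴿ x i + x j) →
                         Distinct (λ i → ∣ half z - x i ∣)
    distances-distinct {x} inc {z} side {a} {b} a≢b eq with ordered a≢b | side a b
    ... | inj₁ a<b | inj₁ r = irrefl (sym eq) (closer-right (inc a<b) (<-respʳ-≈ (sym (half-double z)) r))
    ... | inj₁ a<b | inj₂ r = irrefl eq (closer-left (inc a<b) (<-respˡ-≈ (sym (half-double z)) r))
    ... | inj₂ b<a | inj₁ r = irrefl eq (closer-right (inc b<a)
            (<-resp₂ (+-comm _ _) (sym (half-double z)) r))
    ... | inj₂ b<a | inj₂ r = irrefl (sym eq) (closer-left (inc b<a)
            (<-resp₂ (sym (half-double z)) (+-comm _ _) r))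

    -- A ranking seen from a point strictly between two midpoints of x records their order.
    RP⊆⇒Same : ∀ {x x′ : Point m} → Increasing x → Increasing x′ → DistinctMidpoints x′ →
               RP x ⊆ RP x′ → Same x x′
    RP⊆⇒Same {x} {x′} inc inc′ d′ sub {i} {j} {k} {l} i≢j k≢l p
      with compare (x′ i + x′ j) (x′ k + x′ l)
    ... | tri< q _ _ = q
    ... | tri≈ _ q _ = contradiction p (irrefl (SamePair⇒≈ x (d′ i≢j k≢l q)))
    ... | tri> _ _ q
      -- Seen from `half z`, the midpoint of `i`, `j` has been passed and that of `k`, `l` has not.
      -- A viewpoint `y′` of `x′` with the same ranking lies between the corresponding midpoints of
      -- `x′`, against `q`.
      with z , ij<z , z<kl , side ← avoid₂ (λ i j → x i + x j) p
      with π , s ← sort (λ i → ∣ half z - x i ∣) (distances-distinct inc side)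
      with y′ , s′ ← sub {π} (half z , s) =
        contradiction q (asym (<-trans
          (beyond i≢j (<-respʳ-≈ (sym (half-double z)) ij<z))
          (before k≢l (<-respˡ-≈ (sym (half-double z)) z<kl))))
      where
      move : ∀ {a b} → ∣ half z - x a ∣ <ᴿ ∣ half z - x b ∣ → ∣ y′ - x′ a ∣ <ᴿ ∣ y′ - x′ b ∣
      move = transfer π {λ a → ∣ half z - x a ∣} {λ a → ∣ y′ - x′ a ∣} s s′

      beyond : ∀ {a b} → a ≢ b → x a + x b <ᴿ half z + half z → x′ a + x′ b <ᴿ y′ + y′
      beyond a≢b r with ordered a≢b
      ... | inj₁ a<b = right-half (inc′ a<b) (move (closer-right (inc a<b) r))
      ... | inj₂ b<a = <-respˡ-≈ (+-comm _ _)
              (right-half (inc′ b<a) (move (closer-right (inc b<a) (<-respˡ-≈ (+-comm _ _) r))))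

      before : ∀ {a b} → a ≢ b → half z + half z <ᴿ x a + x b → y′ + y′ <ᴿ x′ a + x′ b
      before a≢b r with ordered a≢b
      ... | inj₁ a<b = left-half (inc′ a<b) (move (closer-left (inc a<b) r))
      ... | inj₂ b<a = <-respʳ-≈ (+-comm _ _)
              (left-half (inc′ b<a) (move (closer-left (inc b<a) (<-respʳ-≈ (+-comm _ _) r))))

    RP-neg : ∀ (x : Point m) → RP x ⊆ RP (λ i → - x i)
    RP-neg x {π} (y , s) = - y , λ {k} {l} k<l → <-resp₂ (mirror (π ⟨$⟩ʳ k)) (mirror (π ⟨$⟩ʳ l)) (s k<l)
      where
      mirror : ∀ i → ∣ y - x i ∣ ≈ ∣ - y - - x i ∣
      mirror i = trans (sym (abs-neg (y - x i)))
        (abs-cong (solve 2 (λ y a → :- (y :- a) := :- y :- (:- a)) refl y (x i)))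

    -- Not an instance of `RP-neg`, since a double negation is only `_≈_` to the original
    -- coordinate.
    RP-neg⁻ : ∀ (x : Point m) → RP (λ i → - x i) ⊆ RP x
    RP-neg⁻ x {π} (y , s) = - y , λ {k} {l} k<l → <-resp₂ (mirror (π ⟨$⟩ʳ k)) (mirror (π ⟨$⟩ʳ l)) (s k<l)
      where
      mirror : ∀ i → ∣ y - - x i ∣ ≈ ∣ - y - x i ∣
      mirror i = trans (sym (abs-neg (y - - x i)))
        (abs-cong (solve 2 (λ y a → :- (y :- (:- a)) := :- y :- a) refl y (x i)))

    -- That `π` ranks `x ∘ᵖ σ` means, by definition, that `π ∘ₚ σ` ranks `x`.
    Equivalent-∘ᵖ : ∀ (x : Point m) σ → Equivalent x (x ∘ᵖ σ)
    Equivalent-∘ᵖ x σ = σ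
      , (λ {ρ} p → ρ ∘ₚ flipₚ σ
           , RP-resp-≈ₚ x {ρ} {(ρ ∘ₚ flipₚ σ) ∘ₚ σ} (λ k → ≡.sym (inverseʳ σ)) p
           , λ k → ≡.sym (inverseʳ σ))
      , λ {ρ} (π , p , ρ≈) → RP-resp-≈ₚ x {π ∘ₚ σ} {ρ} (≡.sym ∘ ρ≈) p

    RP≐⇒Equivalent : ∀ {x x′ : Point m} → RP x ≐ RP x′ → Equivalent x x′
    RP≐⇒Equivalent {x} {x′} (f , g) = idₚ
      , (λ {ρ} p → ρ , f {ρ} p , λ _ → ≡.refl)
      , λ {ρ} (π , p , ρ≈) → RP-resp-≈ₚ x {π} {ρ} (≡.sym ∘ ρ≈) (g {π} p)

    Equivalent-reflect : ∀ (x : Point m) → Equivalent x (reflect x)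
    Equivalent-reflect x = Equivalent-trans x (λ i → - x i) (reflect x)
      (RP≐⇒Equivalent {x} {λ i → - x i} ((λ {π} → RP-neg x {π}) , λ {π} → RP-neg⁻ x {π}))
      (Equivalent-∘ᵖ (λ i → - x i) reverseₚ)

    -- The viewpoint y₂ does not lie to the left of y, so two points ranked oppositely by them
    -- have their midpoint to the right of y.
    opposite-rankings⇒id : ∀ {x : Point m} → Increasing x → ∀ π {y y₂} →
      SortedBy π (λ i → ∣ y - x i ∣) → SortedBy (reverseₚ ∘ₚ π) (λ i → ∣ y₂ - x i ∣) →
      ¬ (y₂ <ᴿ y) → π ≈ₚ idₚ
    opposite-rankings⇒id {x} inc π {y} {y₂} s s₂ y₂≮y = monotone⇒id π mono
      where
      s₂′ : ∀ {k l} → k Fin.< l → ∣ y₂ - x (π ⟨$⟩ʳ l) ∣ <ᴿ ∣ y₂ - x (π ⟨$⟩ʳ k) ∣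
      s₂′ {k} {l} k<l = ≡.subst₂ (λ a b → ∣ y₂ - x (π ⟨$⟩ʳ a) ∣ <ᴿ ∣ y₂ - x (π ⟨$⟩ʳ b) ∣)
        (Fin.opposite-involutive l) (Fin.opposite-involutive k) (s₂ (opposite-anti k<l))

      mono : ∀ {k l} → k Fin.< l → (π ⟨$⟩ʳ k) Fin.< (π ⟨$⟩ʳ l)
      mono k<l with ordered (⟨$⟩ʳ-≢ π (Fin.<⇒≢ k<l))
      ... | inj₁ a<b = a<b
      ... | inj₂ b<a = contradiction
        (<-trans (left-half (inc b<a) (s₂′ k<l)) (right-half (inc b<a) (s k<l)))
        (λ p → y₂≮y (double-cancel-< p))

    mutually-reverse : ∀ {x : Point m} → Increasing x → ∀ π → RP x π → RP x (reverseₚ ∘ₚ π) →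
                       π ≈ₚ idₚ ⊎ π ≈ₚ reverseₚ
    mutually-reverse {x} inc π (y , s) (y₂ , s₂) with y₂ <? y
    ... | no y₂≮y  = inj₁ (opposite-rankings⇒id {x} inc π s s₂ y₂≮y)
    -- The two viewpoints exchange roles: the reversed ranking is the identity, so `π` itself is the
    -- reversal.
    ... | yes y₂<y = inj₂ λ k → ≡.trans
      (≡.cong (π ⟨$⟩ʳ_) (≡.sym (Fin.opposite-involutive k)))
      (opposite-rankings⇒id {x} inc (reverseₚ ∘ₚ π) s₂
        (λ {k} {l} k<l → ≡.subst₂ (λ a b → ∣ y - x (π ⟨$⟩ʳ a) ∣ <ᴿ ∣ y - x (π ⟨$⟩ʳ b) ∣)
          (≡.sym (Fin.opposite-involutive k)) (≡.sym (Fin.opposite-involutive l)) (s k<l))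
        (asym y₂<y) (opposite k))

    id∈RP : ∀ {x : Point m} → Increasing x → RP x idₚ
    id∈RP {x} inc with z , below ← strict-lower-bound x =
      z , λ k<l → closer-left (inc k<l) (+-mono-< (below _) (below _))

    reverse∈RP : ∀ {x : Point m} → Increasing x → RP x reverseₚ
    reverse∈RP {x} inc with z , above ← strict-upper-bound x =
      z , λ k<l → closer-right (inc (opposite-anti k<l)) (+-mono-< (above _) (above _))

    Equivalent⇒Same : ∀ {x x′ : Point m} → Increasing x → Increasing x′ →
                      DistinctMidpoints x′ → Equivalent x x′ → Same x x′ ⊎ Same x (reflect x′)
    Equivalent⇒Same {x} {x′} inc inc′ d′ (σ , f , g) = Sum.map same same-reflected
      (mutually-reverse {x} inc σ
        -- The two extreme rankings of `x′`, seen from far left and far right, are carried to `σ`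
        -- and its reverse; both therefore occur in `RP x`.
        (g {σ} (idₚ , id∈RP {x′} inc′ , λ _ → ≡.refl))
        (g {reverseₚ ∘ₚ σ} (reverseₚ , reverse∈RP {x′} inc′ , λ _ → ≡.refl)))
      where
      same : σ ≈ₚ idₚ → Same x x′
      same σ≈id = RP⊆⇒Same {x} {x′} inc inc′ d′ (λ {ρ} → sub {ρ})
        where
        sub : RP x ⊆ RP x′
        sub {ρ} p with π , q , ρ≈ ← f {ρ} p =
          RP-resp-≈ₚ x′ {π} {ρ} (λ k → ≡.sym (≡.trans (ρ≈ k) (σ≈id (π ⟨$⟩ʳ k)))) q

      same-reflected : σ ≈ₚ reverseₚ → Same x (reflect x′)
      same-reflected σ≈rev = RP⊆⇒Same {x} {reflect x′} inc (Increasing-reflect {x = x′} inc′)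
        (DistinctMidpoints-reflect {x = x′} d′) (λ {ρ} → sub {ρ})
        where
        sub : RP x ⊆ RP (reflect x′)
        sub {ρ} p with π , q , ρ≈ ← f {ρ} p =
          -- `reflect x′` is the negated point read through `reverseₚ`, so `ρ` ranks it exactly when
          -- `ρ ∘ₚ reverseₚ` ranks the negated point.
          RP-resp-≈ₚ (λ i → - x′ i) {π} {ρ ∘ₚ reverseₚ}
            (λ k → ≡.sym (≡.trans (≡.cong opposite (≡.trans (ρ≈ k) (σ≈rev (π ⟨$⟩ʳ k))))
              (Fin.opposite-involutive (π ⟨$⟩ʳ k))))
            (RP-neg x′ {π} q)

-- Chambers

module Chambers (em : ExcludedMiddle 0ℓ) (ℝ : CompleteOrderedField) where
  open CompleteOrderedField ℝ
  open Euclidean ℝ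
  open RankingPatterns ℝ
  open OrderedField ℝ
  open MidpointOrders ℝ
  open CommutativeRing commutativeRing
    using (refl; sym; trans; +-cong; +-congʳ; +-congˡ; +-identityʳ; -‿inverseʳ; -‿cong;
           *-congʳ; *-congˡ; *-identityʳ)
  open IsStrictTotalOrder isStrictTotalOrder
    using (compare; irrefl; asym; <-respˡ-≈) renaming (trans to <-trans)
  open IntegerRingSolver commutativeRing

  module _ {m : ℕ} where

    -- A predicate on points need not respect coordinatewise `_≈_`, but an open one does: such
    -- points are within every ε of each other.
    Open⇒resp : ∀ {U : Pred (Point m) 0ℓ} → Open U → ∀ {x y} → (∀ i → y i ≈ x i) → x ∈ U → y ∈ U
    Open⇒resp oU {x} {y} y≈x xU with ε , 0<ε , ball ← oU xU = ball λ i →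
      ∣x∣<z (<-respˡ-≈ (sym (y-x≈0 i)) 0<ε)
        (<-respˡ-≈ (sym (trans (-‿cong (y-x≈0 i)) (solve 0 (:- con (+ 0) := con (+ 0)) refl))) 0<ε)
      where
      y-x≈0 : ∀ i → y i - x i ≈ 0#
      y-x≈0 i = trans (+-congʳ (y≈x i)) (-‿inverseʳ (x i))

    halfspace : (i j k l : Fin m) → Pred (Point m) 0ℓ
    halfspace i j k l x = x i + x j <ᴿ x k + x l

    -- Four coordinates move, each by less than ε, so a quarter of the gap between the two sums is a
    -- safe radius.
    halfspace-open : ∀ i j k l → Open (halfspace i j k l)
    halfspace-open i j k l {x} p = ε , half-pos (half-pos (diff p)) , λ {y} near →
      let yi< = proj₁ (∣-∣-<⇒ (near i))
          yj< = proj₁ (∣-∣-<⇒ (near j))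
          xk< = proj₂ (∣-∣-<⇒ (near k))
          xl< = proj₂ (∣-∣-<⇒ (near l))
      in <-via (+-pos (+-pos (diff yi<) (diff yj<)) (+-pos (diff xk<) (diff xl<)))
           (trans (solve 9 (λ yi yj yk yl xi xj xk xl e →
               (((xi :+ e) :- yi) :+ ((xj :+ e) :- yj)) :+ (((yk :+ e) :- xk) :+ ((yl :+ e) :- xl)) :=
               ((yk :+ yl) :- (yi :+ yj)) :+ (((e :+ e) :+ (e :+ e)) :- ((xk :+ xl) :- (xi :+ xj))))
             refl (y i) (y j) (y k) (y l) (x i) (x j) (x k) (x l) ε)
           (trans (+-congˡ (trans (+-congʳ 4ε) (-‿inverseʳ gap))) (+-identityʳ _)))
      where
      gap ε : Carrier
      gap = (x k + x l) - (x i + x j)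
      ε   = half (half gap)
      4ε : (ε + ε) + (ε + ε) ≈ gap
      4ε = trans (+-cong (half-double (half gap)) (half-double (half gap))) (half-double gap)

    -- Off the hyperplane, a connected set is covered by two disjoint open half-spaces, so it cannot
    -- meet both.
    halfspace-constant : ∀ {X : Pred (Point m) 0ℓ} {i j k l} →
      (∀ {z} → z ∈ X → ¬ (z i + z j ≈ z k + z l)) →
      ∀ {x y} → SameComponent X x y → x i + x j <ᴿ x k + x l → y i + y j <ᴿ y k + y l
    halfspace-constant {X} {i} {j} {k} {l} off {x} {y} (S , S⊆X , connected , xS , yS) p =
      [ (λ q → q) , (λ q → contradiction (meet q) disjoint) ]′ (side yS)
      where
      U V : Pred (Point m) 0ℓ
      U = halfspace i j k l
      V = halfspace k l i j

      side : S ⊆ U ∪ V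
      side {z} zS = ≉⇒<⊎> (off {z} (S⊆X {z} zS))

      meet : y ∈ V → Satisfiable (S ∩ (U ∩ V))
      meet q = connected U V (halfspace-open i j k l) (halfspace-open k l i j)
        (λ {z} → side {z}) (x , xS , p) (y , yS , q)

      disjoint : ¬ Satisfiable (S ∩ (U ∩ V))
      disjoint (_ , _ , zU , zV) = asym zU zV

    SameComponent⇒Same : ∀ {X : Pred (Point m) 0ℓ} → (∀ {z} → z ∈ X → DistinctMidpoints z) →
                         ∀ {x y} → SameComponent X x y → Same x y
    SameComponent⇒Same {X} dist {x} {y} comp {i} {j} {k} {l} i≢j k≢l p =
      halfspace-constant {X} {i} {j} {k} {l} off {x} {y} comp p
      where
      off : ∀ {z} → z ∈ X → ¬ (z i + z j ≈ z k + z l)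
      -- A tie at `z` can only be that of a pair with itself, and would hold at `x` too, against
      -- `p`.
      off zX eq = irrefl (SamePair⇒≈ x (dist zX i≢j k≢l eq)) p

    -- Connectedness of convex sets

    segment : Point m → Point m → Carrier → Point m
    segment a b t i = a i + t * (b i - a i)

    segment-+ : ∀ a b t i j → (a i + a j) + t * ((b i + b j) - (a i + a j)) ≈
                              segment a b t i + segment a b t j
    segment-+ a b t i j = solve 5 (λ ai aj bi bj t →
        (ai :+ aj) :+ t :* ((bi :+ bj) :- (ai :+ aj)) :=
        (ai :+ t :* (bi :- ai)) :+ (aj :+ t :* (bj :- aj)))
      refl (a i) (a j) (b i) (b j) t

    segment-halfspace : ∀ {a b i j k l t} → ¬ (t <ᴿ 0#) → ¬ (1# <ᴿ t) →
      a ∈ halfspace i j k l → b ∈ halfspace i j k l → segment a b t ∈ halfspace i j k l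
    segment-halfspace {a} {b} {i} {j} {k} {l} {t} t≮0 1≮t pa pb =
      <-resp₂ (segment-+ a b t i j) (segment-+ a b t k l) (interpolate-< t≮0 1≮t pa pb)

    segment-continuous : ∀ a b s {ε} → 0# <ᴿ ε → ∃ λ δ → 0# <ᴿ δ ×
      (∀ {t} → t <ᴿ s + δ → s <ᴿ t + δ → ∀ i → ∣ segment a b t i - segment a b s i ∣ <ᴿ ε)
    segment-continuous a b s {ε} 0<ε
      -- `0#` joins the family to make `M` positive; then δ = ε / M, as no coordinate of the segment
      -- changes faster than `M`.
      with M , bound ← strict-upper-bound (0# ∷ λ i → ∣ b i - a i ∣)
      with M⁻¹ , 0<M⁻¹ , MM⁻¹≈1 ← inverse-pos (bound zero) =
        ε * M⁻¹ , *-pos 0<ε 0<M⁻¹ , close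
      where
      close : ∀ {t} → t <ᴿ s + ε * M⁻¹ → s <ᴿ t + ε * M⁻¹ →
              ∀ i → ∣ segment a b t i - segment a b s i ∣ <ᴿ ε
      close {t} t<s+δ s<t+δ i = ∣x∣<z
        (<-resp₂ (solve 4 (λ a b s t → (t :- s) :* (b :- a) :=
                     (a :+ t :* (b :- a)) :- (a :+ s :* (b :- a))) refl (a i) (b i) s t)
          δM≈ε (product-bound w<δ -w<δ c<M -c<M))
        (<-resp₂ (solve 4 (λ a b s t → (t :- s) :* (:- (b :- a)) :=
                     :- ((a :+ t :* (b :- a)) :- (a :+ s :* (b :- a)))) refl (a i) (b i) s t)
          δM≈ε (product-bound w<δ -w<δ -c<M
            (<-respˡ-≈ (solve 1 (λ c → c := :- (:- c)) refl (b i - a i)) c<M)))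
        where
        c<M : b i - a i <ᴿ M
        c<M = ∣x∣<z⇒x<z (bound (suc i))
        -c<M : - (b i - a i) <ᴿ M
        -c<M = ∣x∣<z⇒-x<z (bound (suc i))
        w<δ : t - s <ᴿ ε * M⁻¹
        w<δ = <-via (diff t<s+δ)
          (solve 3 (λ s t d → (s :+ d) :- t := d :- (t :- s)) refl s t (ε * M⁻¹))
        -w<δ : - (t - s) <ᴿ ε * M⁻¹
        -w<δ = <-via (diff s<t+δ)
          (solve 3 (λ s t d → (t :+ d) :- s := d :- (:- (t :- s))) refl s t (ε * M⁻¹))
        δM≈ε : ε * M⁻¹ * M ≈ ε
        δM≈ε = trans (solve 3 (λ e i m → e :* i :* m := e :* (m :* i)) refl ε M⁻¹ M)
                     (trans (*-congˡ MM⁻¹≈1) (*-identityʳ ε))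

    between : Point m → Point m → Pred (Point m) 0ℓ
    between x y z = ∀ {i j k l} → x ∈ halfspace i j k l → y ∈ halfspace i j k l → z ∈ halfspace i j k l

    -- The supremum of the t at which the segment from U to V lies in U
    -- is a point of U ∩ V or contradicts the openness of U or of V.
    between-connected : ∀ x y → Connected (between x y)
    between-connected x y U V oU oV cover (a , aS , aU) (b , bS , bV) =
      -- `Connected` asks for a point of U ∩ V, while the supremum argument only refutes its
      -- absence.
      decidable-stable em λ disjoint →
        [ sup-not-in-U disjoint , sup-not-in-V disjoint ]′ (cover {segment a b s} (inS s≮0 1≮s))
      where
      inS : ∀ {t} → ¬ (t <ᴿ 0#) → ¬ (1# <ᴿ t) → segment a b t ∈ between x y
      inS t≮0 1≮t px py = segment-halfspace {a} {b} t≮0 1≮t (aS px py) (bS px py)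

      T : Pred Carrier 0ℓ
      T t = ¬ (t <ᴿ 0#) × ¬ (1# <ᴿ t) × segment a b t ∈ U

      0∈T : T 0#
      0∈T = <-irrefl , asym 0<1 , Open⇒resp {U} oU {a} {segment a b 0#}
        (λ i → solve 2 (λ a b → a :+ con (+ 0) :* (b :- a) := a) refl (a i) (b i)) aU

      1-above : 1# IsUpperBoundOf T
      1-above _ = proj₁ ∘ proj₂

      least-upper-bound : ∃ λ s → s IsUpperBoundOf T × (∀ c → c IsUpperBoundOf T → ¬ (c <ᴿ s))
      least-upper-bound = supremum T (0# , 0∈T) (1# , 1-above)

      s : Carrier
      s = proj₁ least-upper-bound

      upper : s IsUpperBoundOf T
      upper = proj₁ (proj₂ least-upper-bound)

      least-upper : ∀ c → c IsUpperBoundOf T → ¬ (c <ᴿ s)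
      least-upper = proj₂ (proj₂ least-upper-bound)

      s≮0 : ¬ (s <ᴿ 0#)
      s≮0 = upper 0# 0∈T

      1≮s : ¬ (1# <ᴿ s)
      1≮s = least-upper 1# 1-above

      module _ (disjoint : ¬ Satisfiable (between x y ∩ (U ∩ V))) where

        sup-not-1 : segment a b s ∈ U → ¬ (s ≈ 1#)
        sup-not-1 sU s≈1 = disjoint (b , bS , Open⇒resp {U} oU {segment a b s} {b} b≈ sU , bV)
          where
          b≈ : ∀ i → b i ≈ segment a b s i
          b≈ i = trans (solve 2 (λ a b → b := a :+ con (+ 1) :* (b :- a)) refl (a i) (b i))
                       (+-congˡ (*-congʳ (trans (+-identityʳ 1#) (sym s≈1))))

        -- By openness the segment stays in U slightly beyond s < 1, which puts a parameter larger
        -- than s into `T`.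
        sup-not-in-U : ¬ (segment a b s ∈ U)
        sup-not-in-U sU =
          [ not-below-1 , 1≮s ]′ (≉⇒<⊎> (sup-not-1 sU))
          where
          not-below-1 : ¬ (s <ᴿ 1#)
          not-below-1 s<1 =
            let ε , 0<ε , ball              = oU {segment a b s} sU
                δ , 0<δ , close             = segment-continuous a b s 0<ε
                t , s<t , t<s+δ , t<1       = dense-below-both (x<x+pos 0<δ) s<1
            in upper t
                 ( asym (≮-<-trans s≮0 s<t) , asym t<1
                 , ball {segment a b t} (close t<s+δ (<-trans s<t (x<x+pos 0<δ))) )
                 s<t

        -- By openness the segment lies in V slightly before s as well, so no parameter there
        -- belongs to `T`, and s - δ is a smaller upper bound.
        sup-not-in-V : ¬ (segment a b s ∈ V)
        sup-not-in-V sV =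
          let ε , 0<ε , ball  = oV {segment a b s} sV
              δ , 0<δ , close = segment-continuous a b s 0<ε
          in least-upper (s - δ)
               (λ t tT@(t≮0 , 1≮t , tU) p → disjoint
                 ( segment a b t , inS t≮0 1≮t , tU
                 , ball {segment a b t} (close (≮-<-trans (upper t tT) (x<x+pos 0<δ))
                     (<-via (diff p)
                       (solve 3 (λ s t d → t :- (s :- d) := (t :+ d) :- s) refl s t δ))) ))
               (<-via 0<δ (solve 2 (λ s d → d := s :- (s :- d)) refl s δ))

    -- `between x y` contains both points. It avoids the hyperplanes because x and y strictly order
    -- any two different midpoints in the same way, and its members inherit that inequality.
    Same⇒SameComponent : 3 ℕ.≤ m → ∀ {x y} → DistinctMidpoints x → Same x y →
                         SameComponent (Arrangement.complement (𝓜 m)) x y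
    Same⇒SameComponent 3≤m {x} {y} d same =
      between x y , (λ {z} → off {z}) , between-connected x y , (λ p _ → p) , (λ _ p → p)
      where
      distinct : ∀ {z} → z ∈ between x y → DistinctMidpoints z
      distinct {z} z∈ {i} {j} {k} {l} i≢j k≢l eq with compare (x i + x j) (x k + x l)
      ... | tri< p _ _ = contradiction (z∈ {i} {j} {k} {l} p (same i≢j k≢l p)) (irrefl eq)
      ... | tri≈ _ p _ = d i≢j k≢l p
      ... | tri> _ _ p = contradiction (z∈ {k} {l} {i} {j} p (same k≢l i≢j p)) (irrefl (sym eq))

      off : between x y ⊆ Arrangement.complement (𝓜 m)
      off {z} z∈ = DistinctMidpoints⇒off 3≤m {z} (distinct {z} z∈)

-- Counting

open import Data.Nat.Base using (_*_; _≤_)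

module _ {a ℓ : Level} (S : Setoid a ℓ) where
  open Setoid S

  hasCardinality-by : ∀ {n} (f : Fin n → Carrier) → (∀ i j → f i ≈ f j → i ≡ j) →
                      (∀ s → ∃ λ i → f i ≈ s) → S hasCardinality n
  hasCardinality-by f inj sur = record
    { to        = f
    ; cong      = λ { ≡.refl → refl }
    ; bijective = inj _ _
                , λ s → let i , eq = sur s in i , λ { ≡.refl → eq }
    }

  hasCardinality-× : ∀ {n k} (f : Fin n × Fin k → Carrier) → (∀ p q → f p ≈ f q → p ≡ q) →
                     (∀ s → ∃ λ p → f p ≈ s) → S hasCardinality (n * k)
  hasCardinality-× {n} {k} f inj sur = hasCardinality-by (f ∘ remQuot {n} k)
    (λ i j eq → begin
      i                                   ≡⟨ Fin.combine-remQuot {n} k i ⟨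
      uncurry combine (remQuot {n} k i)
        ≡⟨ ≡.cong (uncurry combine) (inj (remQuot {n} k i) (remQuot {n} k j) eq) ⟩
      uncurry combine (remQuot {n} k j)   ≡⟨ Fin.combine-remQuot {n} k j ⟩
      j                                   ∎)
    λ s → let (i , j) , eq = sur s in
      combine i j , ≡.subst (λ p → f p ≈ s) (≡.sym (Fin.remQuot-combine {n} {k} i j)) eq
    where open ≡.≡-Reasoning

module Counting (em : ExcludedMiddle 0ℓ) (ℝ : CompleteOrderedField) where
  open CompleteOrderedField ℝ hiding (_*_)
  open Euclidean ℝ
  open RankingPatterns ℝ
  open OrderedField ℝ
  open MidpointOrders ℝ
  open Chambers em ℝ
  open CommutativeRing commutativeRing
    using (refl; sym; trans; reflexive; +-cong; +-comm; -‿cong)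
  open IsStrictTotalOrder isStrictTotalOrder using (irrefl; asym; <-respˡ-≈; <-respʳ-≈)
  open IntegerRingSolver commutativeRing using (solve; _:+_; :-_; _:=_)

  Same-resp : ∀ {m} {x x′ y y′ : Point m} → (∀ i → x i ≈ y i) → (∀ i → x′ i ≈ y′ i) →
              Same x x′ → Same y y′
  Same-resp p q same i≢j k≢l r = <-resp₂ (+-cong (q _) (q _)) (+-cong (q _) (q _))
    (same i≢j k≢l (<-resp₂ (+-cong (sym (p _)) (sym (p _))) (+-cong (sym (p _)) (sym (p _))) r))

  reflect-involutive : ∀ {m} (x : Point m) i → reflect (reflect x) i ≈ x i
  reflect-involutive x i = trans (solve 1 (λ a → :- (:- a) := a) refl _)
    (reflexive (≡.cong x (Fin.opposite-involutive i)))

  Ordering : ∀ {m} → Pred (Point m) 0ℓ → Pred (Point m) 0ℓ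
  Ordering P x = DistinctMidpoints x × Increasing x × P x

  -- With `Unrestricted` the classes number r₀; with `OuterFirst`, for m ≥ 4, they number r_IE.
  midpointOrders : ∀ {m} → Pred (Point m) 0ℓ → Setoid 0ℓ 0ℓ
  midpointOrders {m} P = record
    { Carrier       = Σ (Point m) (Ordering P)
    ; _≈_           = Same on proj₁
    ; isEquivalence = record
      { refl  = λ _ _ p → p
      ; sym   = λ {(x , d , _)} {(y , _)} → Same-sym {x = x} {y} d
      ; trans = λ {(x , _)} {(y , _)} {(z , _)} → Same-trans {x = x} {y} {z}
      }
    }

  -- A class is fixed by the outcomes of the comparisons, one for each quadruple of indices.
  midpointOrders-finite : ∀ {m} (P : Pred (Point m) 0ℓ) → ∃ λ r → midpointOrders P hasCardinality r
  midpointOrders-finite {m} P =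
    let r , e , inj , sur = representatives em {Σ (Point m) (Ordering P)} ((m * m) * (m * m))
                              (λ t a → test (decode t) (proj₁ a))
    in r , hasCardinality-by (midpointOrders P) e
      (λ a b same → inj a b λ t → mk⇔
        (transport {proj₁ (e a)} {proj₁ (e b)} same (decode t))
        (transport {proj₁ (e b)} {proj₁ (e a)}
          (Same-sym {x = proj₁ (e a)} {proj₁ (e b)} (proj₁ (proj₂ (e a))) same) (decode t)))
      λ a → let i , eq = sur a in i , λ {i} {j} {k} {l} i≢j k≢l p →
        proj₂ (proj₂ (≡.subst (λ q → test q (proj₁ (e _)) → test q (proj₁ a)) (decode-encode i j k l)
          (Equivalence.to (eq (combine (combine i j) (combine k l)))) (i≢j , k≢l , p)))
    where
    Quad : Set
    Quad = (Fin m × Fin m) × (Fin m × Fin m)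

    decode : Fin ((m * m) * (m * m)) → Quad
    decode t = let p , q = remQuot {m * m} (m * m) t in remQuot {m} m p , remQuot {m} m q

    decode-encode : ∀ i j k l → decode (combine (combine i j) (combine k l)) ≡ ((i , j) , (k , l))
    decode-encode i j k l = ≡.trans
      (≡.cong (λ (p , q) → remQuot {m} m p , remQuot {m} m q)
        (Fin.remQuot-combine (combine i j) (combine k l)))
      (≡.cong₂ _,_ (Fin.remQuot-combine i j) (Fin.remQuot-combine k l))

    test : Quad → Pred (Point m) 0ℓ
    test ((i , j) , (k , l)) x = i ≢ j × k ≢ l × x i + x j <ᴿ x k + x l

    transport : ∀ {x y} → Same x y → ∀ q → test q x → test q y
    transport same q (i≢j , k≢l , p) = i≢j , k≢l , same i≢j k≢l p

  Unrestricted : ∀ {m} → Pred (Point m) 0ℓ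
  Unrestricted _ = ⊤

  module _ {m n : ℕ} (B : midpointOrders {m} Unrestricted hasCardinality n) where
    open Bijection B using (to; injective; strictlySurjective)

    private
      point : Fin n → Point m
      point = proj₁ ∘ to

      midpoints : ∀ a → DistinctMidpoints (point a)
      midpoints = proj₁ ∘ proj₂ ∘ to

      increasing : ∀ a → Increasing (point a)
      increasing = proj₁ ∘ proj₂ ∘ proj₂ ∘ to

    orderedPatterns-count : orderedPatterns m hasCardinality n
    orderedPatterns-count = hasCardinality-by (orderedPatterns m)
      (λ a → point a , DistinctMidpoints⇒Generic {x = point a} (midpoints a) , increasing a)
      (λ a b (f , _) → injective
        (RP⊆⇒Same {x = point a} {point b} (increasing a) (increasing b) (midpoints b) (λ {π} → f {π})))
      λ (x , g , inc) →
        let a , same = strictlySurjective (x , Generic⇒DistinctMidpoints {x = x} g , inc , tt)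
        in a , Same⇒RP≐ {x = point a} {x} (increasing a) inc (midpoints a) same

    module _ (3≤m : 3 ≤ m) where

      -- `Same` also fixes the order of the coordinates. As `x` and `x′` increase, `flipₚ π ∘ₚ π′`
      -- is monotone, hence the identity.
      relabel-unique : ∀ {x x′ : Point m} → Increasing x → Increasing x′ → ∀ π π′ →
                       Same (x ∘ᵖ π) (x′ ∘ᵖ π′) → Same x x′ × π ≈ₚ π′
      relabel-unique {x} {x′} inc inc′ π π′ same =
          Same-resp {x = x ∘ᵖ π ∘ᵖ flipₚ π} {x′ ∘ᵖ π′ ∘ᵖ flipₚ π} {x} {x′}
            (λ i → reflexive (≡.cong x (inverseʳ π)))
            (λ i → reflexive (≡.cong x′ (τ≈id i)))
            (Same-∘ᵖ {x = x ∘ᵖ π} {x′ ∘ᵖ π′} (flipₚ π) same)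
        , λ k → ≡.trans (≡.sym (τ≈id (π ⟨$⟩ʳ k))) (≡.cong (π′ ⟨$⟩ʳ_) (inverseˡ π))
        where
        τ≈id : flipₚ π ∘ₚ π′ ≈ₚ idₚ
        τ≈id = monotone⇒id (flipₚ π ∘ₚ π′) λ {a} {b} a<b → Increasing⇒order {x = x′} inc′
          (Same⇒order 3≤m {x ∘ᵖ π} {x′ ∘ᵖ π′} same
            (≡.subst₂ (λ a b → x a <ᴿ x b) (≡.sym (inverseʳ π)) (≡.sym (inverseʳ π)) (inc a<b)))

      chamber-count : ch (𝓜 m) hasCardinality (n * m !)
      chamber-count = hasCardinality-× (ch (𝓜 m)) chamber chamber-injective chamber-surjective
        where
        chamber : Fin n × Fin (m !) → Setoid.Carrier (ch (𝓜 m))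
        chamber (a , b) = point a ∘ᵖ permutations m b
          , DistinctMidpoints⇒off 3≤m {point a ∘ᵖ permutations m b}
              (DistinctMidpoints-∘ᵖ {x = point a} (permutations m b) (midpoints a))

        chamber-injective : ∀ p q → SameComponent (Arrangement.complement (𝓜 m))
                              (proj₁ (chamber p)) (proj₁ (chamber q)) → p ≡ q
        chamber-injective (a , b) (a′ , b′) comp =
          let same , perm = relabel-unique {point a} {point a′} (increasing a) (increasing a′)
                (permutations m b) (permutations m b′)
                (SameComponent⇒Same {X = Arrangement.complement (𝓜 m)}
                  (λ {z} off → off⇒DistinctMidpoints {x = z} off)
                  {proj₁ (chamber (a , b))} {proj₁ (chamber (a′ , b′))} comp)
          in ≡.cong₂ _,_ (injective same) (permutations-injective m perm)

        chamber-surjective : ∀ z → ∃ λ p → SameComponent (Arrangement.complement (𝓜 m))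
                               (proj₁ (chamber p)) (proj₁ z)
        chamber-surjective (z , off) =
          let d        = off⇒DistinctMidpoints {x = z} off
              π , inc  = sort z (off⇒Distinct {x = z} off)
              a , same = strictlySurjective (z ∘ᵖ π , DistinctMidpoints-∘ᵖ {x = z} π d , inc , tt)
              b , perm = permutations-surjective m (flipₚ π)
          in (a , b) , Same⇒SameComponent 3≤m {point a ∘ᵖ permutations m b} {z}
               (DistinctMidpoints-∘ᵖ {x = point a} (permutations m b) (midpoints a))
               (Same-resp {x = point a ∘ᵖ permutations m b} {z ∘ᵖ π ∘ᵖ permutations m b}
                 (λ _ → refl)
                 (λ k → reflexive (≡.cong z (≡.trans (≡.cong (π ⟨$⟩ʳ_) (perm k)) (inverseʳ π))))
                 (Same-∘ᵖ {x = point a} {z ∘ᵖ π} (permutations m b) same))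

  -- Reversal fixes the pair of `i` and `opposite i`, so reflection just negates its sum.
  reflect-sum : ∀ {m} (x : Point m) i → reflect x i + reflect x (opposite i) ≈ - (x i + x (opposite i))
  reflect-sum x i = trans
    (+-cong refl (-‿cong (reflexive (≡.cong x (Fin.opposite-involutive i)))))
    (solve 2 (λ a b → :- a :+ :- b := :- (b :+ a)) refl (x (opposite i)) (x i))

  -- A generic point is equivalent to its sorted version, and increasing generic points are
  -- equivalent exactly when their midpoint orders agree up to reflection.
  IE-count-by : ∀ {m r} (e : Fin r → Σ (Point m) (Ordering Unrestricted)) →
    (∀ a b → Same (proj₁ (e a)) (proj₁ (e b)) ⊎ Same (proj₁ (e a)) (reflect (proj₁ (e b))) → a ≡ b) →
    (∀ ((x , _) : Σ (Point m) (Ordering Unrestricted)) →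
      ∃ λ a → Same (proj₁ (e a)) x ⊎ Same (proj₁ (e a)) (reflect x)) →
    3 ≤ m → IE-classes m hasCardinality r
  IE-count-by {m} {r} e inj sur 3≤m = hasCardinality-by (IE-classes m)
    (λ a → point a , DistinctMidpoints⇒Generic {x = point a} (midpoints a))
    (λ a b equiv → inj a b
      (Equivalent⇒Same {x = point a} {point b} (increasing a) (increasing b) (midpoints b) equiv))
    λ (z , g) →
      let d       = Generic⇒DistinctMidpoints {x = z} g
          π , inc = sort z (DistinctMidpoints⇒Distinct 3≤m {x = z} d)
          a , or  = sur (z ∘ᵖ π , DistinctMidpoints-∘ᵖ {x = z} π d , inc , tt)
      in a , Equivalent-trans (point a) (z ∘ᵖ π) z
               ([ direct a {z ∘ᵖ π} inc , mirrored a {z ∘ᵖ π} inc ]′ or)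
               (Equivalent-sym z (z ∘ᵖ π) (Equivalent-∘ᵖ z π))
    where
    point : Fin r → Point m
    point = proj₁ ∘ e

    midpoints : ∀ a → DistinctMidpoints (point a)
    midpoints = proj₁ ∘ proj₂ ∘ e

    increasing : ∀ a → Increasing (point a)
    increasing = proj₁ ∘ proj₂ ∘ proj₂ ∘ e

    direct : ∀ a {x} → Increasing x → Same (point a) x → Equivalent (point a) x
    direct a {x} inc same = RP≐⇒Equivalent {x = point a} {x}
      (Same⇒RP≐ {x = point a} {x} (increasing a) inc (midpoints a) same)

    mirrored : ∀ a {x} → Increasing x → Same (point a) (reflect x) → Equivalent (point a) x
    mirrored a {x} inc same = Equivalent-trans (point a) (reflect x) x
      (direct a {reflect x} (Increasing-reflect {x = x} inc) same)
      (Equivalent-sym x (reflect x) (Equivalent-reflect x))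

  -- Reflection for four or more points

  module _ {n : ℕ} where
    private
      m : ℕ
      m = 4 ℕ.+ n

    -- Reflection exchanges the two sides, so exactly one of x and reflect x is OuterFirst.
    OuterFirst : Pred (Point m) 0ℓ
    OuterFirst x = x zero + x (opposite zero) <ᴿ x (suc zero) + x (opposite (suc zero))

    OuterFirst-reflect : ∀ {x} → OuterFirst (reflect x) → ¬ OuterFirst x
    OuterFirst-reflect {x} p q = asym p
      (<-resp₂ (sym (reflect-sum x (suc zero))) (sym (reflect-sum x zero)) (neg-anti-< q))

    OuterFirst-or-reflect : ∀ {x} → DistinctMidpoints x → OuterFirst x ⊎ OuterFirst (reflect x)
    OuterFirst-or-reflect {x} d = Sum.map (λ p → p)
      (λ q → <-resp₂ (sym (reflect-sum x zero)) (sym (reflect-sum x (suc zero))) (neg-anti-< q))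
      -- For m ≥ 4 the indices `suc zero` and `opposite (suc zero)` differ and form a second pair;
      -- for m = 3 they coincide.
      (≉⇒<⊎> λ eq → different (d (λ ()) (λ ()) eq))
      where
      different : ¬ SamePair {m} zero (opposite zero) (suc zero) (opposite (suc zero))
      different (inj₁ (() , _))
      different (inj₂ (() , _))

    OuterFirst-resp : ∀ {x y} → Same x y → OuterFirst x → OuterFirst y
    OuterFirst-resp same = same (λ ()) (λ ())

    module _ {r : ℕ} (B : midpointOrders OuterFirst hasCardinality r) where
      open Bijection B using (to; injective; strictlySurjective)

      private
        point : Fin r → Point m
        point = proj₁ ∘ to

        midpoints : ∀ a → DistinctMidpoints (point a)
        midpoints = proj₁ ∘ proj₂ ∘ to

        increasing : ∀ a → Increasing (point a)
        increasing = proj₁ ∘ proj₂ ∘ proj₂ ∘ to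

        outerFirst : ∀ a → OuterFirst (point a)
        outerFirst = proj₂ ∘ proj₂ ∘ proj₂ ∘ to

        not-reflected : ∀ a b → ¬ Same (point a) (reflect (point b))
        not-reflected a b same = OuterFirst-reflect {point b}
          (OuterFirst-resp {point a} {reflect (point b)} same (outerFirst a)) (outerFirst b)

        reflect-sym : ∀ {x y : Point m} → Same x (reflect y) → Same (reflect x) y
        reflect-sym {x} {y} same = Same-resp {x = reflect x} {reflect (reflect y)} {reflect x} {y}
          (λ _ → refl) (reflect-involutive y) (Same-reflect {x = x} {reflect y} same)

        reflect-cancel : ∀ {x y : Point m} → Same (reflect x) (reflect y) → Same x y
        reflect-cancel {x} {y} same = Same-resp {x = reflect (reflect x)} {y} {x} {y}
          (reflect-involutive x) (λ _ → refl) (reflect-sym {reflect x} {y} same)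

        cover : ∀ ((x , _) : Σ (Point m) (Ordering Unrestricted)) →
                ∃ λ a → Same (point a) x ⊎ Same (point a) (reflect x)
        cover (x , d , inc , _) =
          [ (λ p → map₂ inj₁ (strictlySurjective (x , d , inc , p)))
          , (λ p → map₂ inj₂ (strictlySurjective
              (reflect x , DistinctMidpoints-reflect {x = x} d , Increasing-reflect {x = x} inc , p)))
          ]′ (OuterFirst-or-reflect {x} d)

      IE-count : IE-classes m hasCardinality r
      IE-count = IE-count-by (λ a → point a , midpoints a , increasing a , tt)
        (λ a b → [ injective , (λ same → ⊥-elim (not-reflected a b same)) ]′)
        cover
        (ℕ.s≤s (ℕ.s≤s (ℕ.s≤s ℕ.z≤n)))

      all-orders-count : midpointOrders {m} Unrestricted hasCardinality (2 * r)
      all-orders-count = hasCardinality-× (midpointOrders {m} Unrestricted) order order-injective order-surjective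
        where
        order : Fin 2 × Fin r → Σ (Point m) (Ordering Unrestricted)
        order (zero     , a) = point a , midpoints a , increasing a , tt
        order (suc zero , a) = reflect (point a)
          , DistinctMidpoints-reflect {x = point a} (midpoints a)
          , Increasing-reflect {x = point a} (increasing a) , tt

        order-injective : ∀ p q → Same (proj₁ (order p)) (proj₁ (order q)) → p ≡ q
        order-injective (zero , a)     (zero , b)     same = ≡.cong (zero ,_) (injective same)
        order-injective (zero , a)     (suc zero , b) same = ⊥-elim (not-reflected a b same)
        order-injective (suc zero , a) (zero , b)     same =
          ⊥-elim (not-reflected b a (Same-sym {x = reflect (point a)} {point b}
            (DistinctMidpoints-reflect {x = point a} (midpoints a)) same))
        order-injective (suc zero , a) (suc zero , b) same =
          ≡.cong (suc zero ,_) (injective (reflect-cancel {point a} {point b} same))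

        order-surjective : ∀ ((x , _) : Σ (Point m) (Ordering Unrestricted)) → ∃ λ p → Same (proj₁ (order p)) x
        order-surjective (x , ord) = choose (cover (x , ord))
          where
          choose : (∃ λ a → Same (point a) x ⊎ Same (point a) (reflect x)) →
                   ∃ λ p → Same (proj₁ (order p)) x
          choose (a , inj₁ same) = (zero , a) , same
          choose (a , inj₂ same) = (suc zero , a) , reflect-sym {point a} {x} same

  -- Three points

  three-points : Point 3
  three-points zero             = 0#
  three-points (suc zero)       = 1#
  three-points (suc (suc zero)) = 1# + 1#

  three-points-increasing : Increasing three-points
  three-points-increasing {zero}           {suc zero}       _ = 0<1
  three-points-increasing {zero}           {suc (suc zero)} _ = +-pos 0<1 0<1
  three-points-increasing {suc zero}       {suc (suc zero)} _ = x<x+1 1#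
  three-points-increasing {suc zero}       {suc zero}       (ℕ.s≤s ())
  three-points-increasing {suc (suc zero)} {suc zero}       (ℕ.s≤s ())
  three-points-increasing {suc (suc zero)} {suc (suc zero)} (ℕ.s≤s (ℕ.s≤s ()))

  𝓑₃⊆𝓜₃ : Arrangement.complement (𝓑 3) ⊆ Arrangement.complement (𝓜 3)
  𝓑₃⊆𝓜₃ off (inj₁ i) = off i
  𝓑₃⊆𝓜₃ off (inj₂ (mk _ _ _ _ i≢j i≢k i≢l j≢k j≢l k≢l _ _ _)) =
    no-four-distinct i≢j i≢k i≢l j≢k j≢l k≢l

  Increasing⇒off : ∀ {m} {x : Point m} → Increasing x → Arrangement.complement (𝓑 m) x
  Increasing⇒off inc (mk _ _ i<j) eq = irrefl eq (inc i<j)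

  -- Three indices admit no two disjoint pairs, so distinct coordinates already give distinct
  -- midpoints.
  Increasing⇒DistinctMidpoints : ∀ {x : Point 3} → Increasing x → DistinctMidpoints x
  Increasing⇒DistinctMidpoints {x} inc =
    off⇒DistinctMidpoints {x = x} (𝓑₃⊆𝓜₃ {x} (Increasing⇒off {x = x} inc))

  Increasing-transfer-< : ∀ {m} {x y : Point m} → Increasing x → Increasing y → ∀ {a b} → x a <ᴿ x b → y a <ᴿ y b
  Increasing-transfer-< {x = x} inc inc′ q = inc′ (Increasing⇒order {x = x} inc q)

  -- Two pairs from three indices meet, and what remains is a comparison of two coordinates.
  Increasing⇒Same : ∀ {x y : Point 3} → Increasing x → Increasing y → Same x y
  Increasing⇒Same {x} {y} inc inc′ {i} {j} {k} {l} i≢j k≢l p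
    with i Fin.≟ k | i Fin.≟ l | j Fin.≟ k | j Fin.≟ l
  ... | yes ≡.refl | _ | _ | _ = +-monoʳ-< (y i) (Increasing-transfer-< {x = x} {y} inc inc′
      (+-cancelˡ-< (x i) p))
  ... | no _ | yes ≡.refl | _ | _ = <-respʳ-≈ (+-comm _ _)
    (+-monoʳ-< (y i) (Increasing-transfer-< {x = x} {y} inc inc′
      (+-cancelˡ-< (x i) (<-respʳ-≈ (+-comm _ _) p))))
  ... | no _ | no _ | yes ≡.refl | _ = <-respˡ-≈ (+-comm _ _)
    (+-monoʳ-< (y j) (Increasing-transfer-< {x = x} {y} inc inc′
      (+-cancelˡ-< (x j) (<-respˡ-≈ (+-comm _ _) p))))
  ... | no _ | no _ | no _ | yes ≡.refl =
    +-monoˡ-< (y j) (Increasing-transfer-< {x = x} {y} inc inc′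
      (+-cancelʳ-< (x j) p))
  ... | no i≢k | no i≢l | no j≢k | no j≢l = no-four-distinct i≢j i≢k i≢l j≢k j≢l k≢l

  three-orders-count : midpointOrders {3} Unrestricted hasCardinality 1
  three-orders-count = hasCardinality-by (midpointOrders {3} Unrestricted) {1}
    (λ _ → three-points , Increasing⇒DistinctMidpoints {three-points} three-points-increasing
         , three-points-increasing , tt)
    (λ { zero zero _ → ≡.refl })
    λ (x , _ , inc , _) → zero , Increasing⇒Same {three-points} {x} three-points-increasing inc

  IE₃-count : IE-classes 3 hasCardinality 1
  IE₃-count = IE-count-by {r = 1}
    (λ _ → three-points , Increasing⇒DistinctMidpoints {three-points} three-points-increasing
         , three-points-increasing , tt)
    (λ { zero zero _ → ≡.refl })
    (λ (x , _ , inc , _) → zero , inj₁ (Increasing⇒Same {three-points} {x} three-points-increasing inc))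
    ℕ.≤-refl

  -- `SameComponent` involves the ambient set only through inclusions, so the same connected sets
  -- serve; this carries the count from `𝓜 3` to `𝓑 3`.
  components-⊆⊇ : ∀ {m n} {X Y : Pred (Point m) 0ℓ} → X ⊆ Y → Y ⊆ X →
                  components X hasCardinality n → components Y hasCardinality n
  components-⊆⊇ {X = X} {Y} X⊆Y Y⊆X B = hasCardinality-by (components Y)
    (λ a → proj₁ (to a) , X⊆Y {proj₁ (to a)} (proj₂ (to a)))
    (λ _ _ (S , S⊆Y , rest) → injective (S , (λ {z} → Y⊆X {z} ∘ S⊆Y {z}) , rest))
    λ (y , yY) →
      let a , S , S⊆X , rest = strictlySurjective (y , Y⊆X {y} yY)
      in a , S , (λ {z} → X⊆Y {z} ∘ S⊆X {z}) , rest
    where open Bijection B using (to; injective; strictlySurjective)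

  𝓑₃-count : ch (𝓑 3) hasCardinality (1 * 3 !)
  𝓑₃-count = components-⊆⊇ {X = Arrangement.complement (𝓜 3)} {Arrangement.complement (𝓑 3)}
    (λ off → off ∘ inj₁) (λ {x} → 𝓑₃⊆𝓜₃ {x}) (chamber-count three-orders-count ℕ.≤-refl)

theorem3p3 :
    ExcludedMiddle 0ℓ → (ℝ : CompleteOrderedField) →
    let open Euclidean ℝ
        open RankingPatterns ℝ in
    (m : ℕ) → 3 ≤ m →
    ∃ λ (rIE : ℕ) → ∃ λ (r₀ : ℕ) →
      (IE-classes m hasCardinality rIE) ×
      (orderedPatterns m hasCardinality r₀) ×
      (m ≡ 3 → ∃ λ (c : ℕ) → (ch (𝓑 3) hasCardinality c) ×
        (rIE ≡ r₀) × (+ r₀ / 1 ≡ + c / (3 !)) × (+ c / (3 !) ≡ 1ℚ)) ×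
      (4 ≤ m → ∃ λ (c : ℕ) → (ch (𝓜 m) hasCardinality c) ×
        (+ rIE / 1 ≡ + r₀ / 2) × (+ r₀ / 2 ≡ (+ c / (2 * m !)) {{2*m!≢0 m}}))
theorem3p3 em ℝ 0 ()
theorem3p3 em ℝ 1 (ℕ.s≤s ())
theorem3p3 em ℝ 2 (ℕ.s≤s (ℕ.s≤s ()))
theorem3p3 em ℝ 3 _ = 1 , 1 , IE₃-count , orderedPatterns-count three-orders-count
  , (λ _ → 1 * 3 ! , 𝓑₃-count , ≡.refl , ≡.refl , ≡.refl)
  , λ { (ℕ.s≤s (ℕ.s≤s (ℕ.s≤s ()))) }
  where open Counting em ℝ
theorem3p3 em ℝ m@(suc (suc (suc (suc n)))) 3≤m =
  let open Counting em ℝ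
      -- `r` counts the orders up to reflection and `2 * r` all of them, so both fractions reduce to
      -- `r`.
      r , B = midpointOrders-finite OuterFirst
      A     = all-orders-count B
  in r , 2 * r , IE-count B , orderedPatterns-count A , (λ ())
   , λ _ → (2 * r) * m ! , chamber-count A 3≤m
         , /-cross r 1 (2 * r) 2 (halve r)
         , /-cross (2 * r) 2 ((2 * r) * m !) (2 * m !) {{_}} {{2*m!≢0 m}} (regroup (2 * r) (m !))
  where
  halve : ∀ r → r * 2 ≡ 2 * r * 1
  halve r = ≡.trans (ℕ.*-comm r 2) (≡.sym (ℕ.*-identityʳ (2 * r)))

  regroup : ∀ a b → a * (2 * b) ≡ a * b * 2
  regroup a b = ≡.trans (≡.cong (a *_) (ℕ.*-comm 2 b)) (≡.sym (ℕ.*-assoc a b 2))
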